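{- Let $r\ge 2$ be an integer and let $H$ be a finite hypergraph (multiple edges allowed) in which every edge has at most $r$ vertices and no edge of $H$ consists of a twin set. Then there is a weighting $\rho: E(H)\to \{1,2,\ldots,\max\{5,r+1\}\}$ such that the induced vertex weights $\rho(v):=\sum_{e\in E(H),\, e\ni v}\rho(e)$, $v\in V(H)$, properly color $V(H)$.
   Context: A hypergraph $H$ consists of a vertex set $V(H)$ and a collection $E(H)$ of subsets of $V(H)$, called edges; multiple edges are allowed, i.e. $E(H)$ may contain the same subset several times (each copy is a separate edge with its own weight, and sums over edges count copies separately). Edges need not have the same size. A set of vertices of any cardinality is called a twin set if all vertices in the set are contained in exactly the same set of edges. "An edge consists of a twin set" means that the vertex set of the edge is a twin set. In particular, the empty set and every single vertex are twin sets, so the hypothesis excludes edges of size $0$ and $1$. A function on $V(H)$ properly colors $V(H)$ if no edge is monochromatic, i.e. every edge contains at least two vertices with different values. -}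

module Defs where

open import Algebra.Properties.CommutativeMonoid.Sum using (sum)
open import Data.Bool.Base using (if_then_else_)
open import Data.Fin.Base using (Fin)
open import Data.Fin.Subset using (Subset; _∈_)
open import Data.Fin.Subset.Properties using (_∈?_)
open import Data.Nat.Base using (ℕ; _≤_)
open import Data.Nat.Properties using (+-0-commutativeMonoid)
open import Data.Product.Base using (_×_; ∃₂)
open import Function.Bundles using (_⇔_)
open import Relation.Binary.PropositionalEquality using (_≢_)
open import Relation.Nullary.Decidable.Core using (does)

-- Vertex set Fin n, with edges indexed by Fin m.  The family need not be
-- injective: repeated values are parallel edges, each with its own index.
Hypergraph : ℕ → ℕ → Set
Hypergraph n m = Fin m → Subset n

TwinSet : ∀ {n m} → Hypergraph n m → Subset n → Set
TwinSet H S = ∀ u v → u ∈ S → v ∈ S → ∀ e → u ∈ H e ⇔ v ∈ H e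

WeightsIn[1,_] : ∀ {m} → ℕ → (Fin m → ℕ) → Set
WeightsIn[1, k ] ρ = ∀ e → 1 ≤ ρ e × ρ e ≤ k

vertexWeight : ∀ {n m} → Hypergraph n m → (Fin m → ℕ) → Fin n → ℕ
vertexWeight H ρ v =
  sum +-0-commutativeMonoid (λ e → if does (v ∈? H e) then ρ e else 0)

ProperlyColors : ∀ {n m} → Hypergraph n m → (Fin n → ℕ) → Set
ProperlyColors H c = ∀ e → ∃₂ λ u v → u ∈ H e × v ∈ H e × c u ≢ c v

{-# OPTIONS --safe #-}
module Submission where

-- The weights are found by induction on a set M of vertices such that every
-- edge whose value is still free has at least two vertices in M, and any two
-- vertices of M are separated by a free edge or differ in weight through the
-- other edges.  Initially M contains one vertex of each class of twins.
-- Consider the traces of size two that free edges leave on M.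
--
-- A vertex in none of them can be dropped from M.
--
-- If two of them meet in exactly one vertex v, then M - v is peeled by removing
-- vertices that are alone in the trace of some edge, until no such vertex is
-- left.  The remaining set is solved by induction, and the peeled vertices are
-- processed in reverse order, v last, by the algorithm of Kalkowski, Karoński
-- and Pfender with values 1,…,5, where an edge plays the role of the graph edge
-- joining the first two of its vertices.
--
-- Otherwise the traces of size two form a perfect matching of M, and the value
-- of a matching edge does not affect the difference of its two ends.  If every
-- edge contains a matched pair, it suffices that matched vertices differ, which
-- is achieved greedily: each edge has at most r forbidden values.  If not,
-- choose an edge h that contains no matched pair and meets as few pairs as
-- possible, and solve M without these pairs by induction.  As h affects no
-- vertex outside them, its value can be chosen afterwards so that the ends of
-- every removed pair differ.  Finally three of the removed pairs are made
-- disjoint in weight by the values of their matching edges.  By the choice of h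
-- every edge with at most one vertex outside the removed pairs contains a
-- matched pair or meets two of these three.

open import Defs
open import Algebra.Properties.CommutativeMonoid.Sum using (sum; sum-cong-≗; ∑-distrib-+)
open import Data.Bool.Base using (Bool; _∧_; false; if_then_else_; true)
open import Data.Empty using (⊥)
open import Data.Fin.Base using (Fin; suc; toℕ; zero)
open import Data.Fin.Properties
  using (all?; any?; toℕ-injective) renaming (_≟_ to _≟ᶠ_; suc-injective to suc-injectiveᶠ)
open import Data.Fin.Subset
  using (Subset; _-_; _∈_; _∉_; _⊆_; inside; outside; ∣_∣) renaming (⊤ to everything)
open import Data.Fin.Subset.Properties
  using (_∈?_; p⊂q⇒∣p∣<∣q∣; p⊆q⇒∣p∣≤∣q∣; p─q⊆p; p─⊥≡p; x∈p⇒∣p-x∣<∣p∣; x∈p∧x≢y⇒x∈p-y; ∈⊤)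
open import Data.List.Base using (List; []; _∷_; allFin; concatMap; filter; length; map; take; upTo)
open import Data.List.Membership.Propositional using (lose) renaming (_∈_ to _∈ˡ_; _∉_ to _∉ˡ_)
open import Data.List.Membership.Propositional.Properties
  using (∈-allFin; ∈-filter⁺; ∈-filter⁻; ∈-map⁺; ∈-map⁻; ∈-upTo⁻)
open import Data.List.Properties
  using (filter-all; filter-notAll; length-map; length-take; length-upTo)
open import Data.List.Relation.Unary.All as All using (All; []; _∷_)
open import Data.List.Relation.Unary.AllPairs using ([]; _∷_)
open import Data.List.Relation.Unary.Any as Any using (Any; here; there)
open import Data.List.Relation.Unary.Unique.Propositional using (Unique)
open import Data.List.Relation.Unary.Unique.Propositional.Properties
  using (allFin⁺; filter⁺; take⁺; upTo⁺)
open import Data.Nat.Base using (_+_; _<_; _≤_; _⊓_; _⊔_; suc; s≤s; zero; z≤n; ℕ; ⌊_/2⌋)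
open import Data.Nat.Induction using (<-wellFounded)
open import Data.Nat.Properties
  using (+-0-commutativeMonoid; +-assoc; +-cancelʳ-≡; +-cancelˡ-≡; +-comm; +-identityʳ; +-suc;
    <-cmp; <-≤-trans; <⇒≱; _<?_; _≟_; _≤?_; m≢1+n+m; m≤m⊔n; m≤n⇒m≤1+n; m≤n⇒m⊓n≡m; m≤n⊔m;
    suc-injective; ≤-<-trans; ≤-pred; ≤-refl; ≤-reflexive; ≤-trans; ≮⇒≥)
open import Data.Nat.Tactic.RingSolver using (solve-∀)
open import Data.Product.Base using (_,_; _×_; proj₁; proj₂; ∃; ∃-syntax)
open import Data.Sum.Base using (_⊎_; inj₁; inj₂; swap)
open import Data.Unit.Base using (tt; ⊤)
open import Data.Vec.Base using ([]; _∷_; here; tabulate; there)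
open import Data.Vec.Functional using (updateAt)
open import Data.Vec.Functional.Properties using (updateAt-minimal; updateAt-updates)
open import Data.Vec.Properties using ([]=⇒lookup; lookup⇒[]=; lookup∘tabulate)
open import Function.Base using (_∘_; const)
open import Function.Bundles using (mk⇔)
open import Induction.WellFounded using (Acc; acc)
open import Relation.Binary.Definitions using (tri<; tri>; tri≈)
open import Relation.Binary.PropositionalEquality
  using (_≡_; _≢_; cong; cong₂; module ≡-Reasoning; refl; subst; sym; trans)
open import Relation.Nullary
  using (Dec; _×-dec_; _→-dec_; _⊎-dec_; contradiction; does; no; yes; ¬?; ¬_)
open import Relation.Nullary.Decidable using (dec-false; dec-true; decidable-stable; toWitness)
open import Relation.Unary using (Decidable)

-- Finite sets, minimisation and a pigeonhole principle.

private
  variable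
    n : ℕ
    X : Set

⟪_⟫ : {P : Fin n → Set} → Decidable P → Subset n
⟪ P? ⟫ = tabulate (λ i → does (P? i))

∈⟪⟫⁺ : {P : Fin n → Set} (P? : Decidable P) {i : Fin n} → P i → i ∈ ⟪ P? ⟫
∈⟪⟫⁺ P? {i} p =
  lookup⇒[]= i _ (trans (lookup∘tabulate (λ i → does (P? i)) i) (dec-true (P? i) p))

∈⟪⟫⁻ : {P : Fin n → Set} (P? : Decidable P) {i : Fin n} → i ∈ ⟪ P? ⟫ → P i
∈⟪⟫⁻ P? {i} i∈ with P? i | trans (sym (lookup∘tabulate (λ i → does (P? i)) i)) ([]=⇒lookup i∈)
... | yes p | _ = p
... | no _ | ()

x∉p-x : (x : Fin n) (p : Subset n) → x ∉ p - x
x∉p-x zero (b ∷ p) ()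
x∉p-x (suc x) (b ∷ p) (there x∈) = x∉p-x x p x∈

∈-⁻ : (p : Subset n) {x y : Fin n} → y ∈ p - x → y ∈ p × y ≢ x
∈-⁻ p y∈ = p─q⊆p p _ y∈ , λ { refl → x∉p-x _ p y∈ }

∣p∣≤1+∣p-x∣ : (p : Subset n) (x : Fin n) → ∣ p ∣ ≤ suc ∣ p - x ∣
∣p∣≤1+∣p-x∣ (inside ∷ p) zero = s≤s (≤-reflexive (cong ∣_∣ (sym (p─⊥≡p p))))
∣p∣≤1+∣p-x∣ (outside ∷ p) zero = m≤n⇒m≤1+n (≤-reflexive (cong ∣_∣ (sym (p─⊥≡p p))))
∣p∣≤1+∣p-x∣ (inside ∷ p) (suc x) = s≤s (∣p∣≤1+∣p-x∣ p x)
∣p∣≤1+∣p-x∣ (outside ∷ p) (suc x) = ∣p∣≤1+∣p-x∣ p x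

elements : Subset n → List (Fin n)
elements [] = []
elements (inside ∷ p) = zero ∷ map suc (elements p)
elements (outside ∷ p) = map suc (elements p)

length-elements : (p : Subset n) → length (elements p) ≡ ∣ p ∣
length-elements [] = refl
length-elements (inside ∷ p) = cong suc (trans (length-map suc (elements p)) (length-elements p))
length-elements (outside ∷ p) = trans (length-map suc (elements p)) (length-elements p)

∈-elements⁺ : (p : Subset n) {x : Fin n} → x ∈ p → x ∈ˡ elements p
∈-elements⁺ (inside ∷ p) here = here refl
∈-elements⁺ (inside ∷ p) (there x∈) = there (∈-map⁺ suc (∈-elements⁺ p x∈))
∈-elements⁺ (outside ∷ p) (there x∈) = ∈-map⁺ suc (∈-elements⁺ p x∈)

∈-elements⁻ : (p : Subset n) {x : Fin n} → x ∈ˡ elements p → x ∈ p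
∈-elements⁻ (inside ∷ p) (here refl) = here
∈-elements⁻ (inside ∷ p) (there x∈) with ∈-map⁻ suc x∈
... | _ , y∈ , refl = there (∈-elements⁻ p y∈)
∈-elements⁻ (outside ∷ p) x∈ with ∈-map⁻ suc x∈
... | _ , y∈ , refl = there (∈-elements⁻ p y∈)

argmin : {P : Fin n → Set} → Decidable P → (f : Fin n → ℕ) → ∃ P →
         ∃[ i ] (P i × ∀ j → P j → f i ≤ f j)
argmin {P = P} P? f (i , p) = go i p (<-wellFounded (f i))
  where
  go : ∀ i → P i → Acc _<_ (f i) → ∃[ i ] (P i × ∀ j → P j → f i ≤ f j)
  go i p (acc rs) with any? (λ j → P? j ×-dec f j <? f i)
  ... | yes (j , pj , lt) = go j pj (rs lt)
  ... | no ¬lt = i , p , λ j pj → ≮⇒≥ (λ lt → ¬lt (j , pj , lt))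

-- The first rejected element is the only one, since `ts` has no repetitions; everything after it
-- passes the filter.
length≤1+filter : {P : ℕ → Set} (P? : Decidable P) →
                  (∀ s t → ¬ P s → ¬ P t → s ≡ t) →
                  ∀ ts → Unique ts → length ts ≤ suc (length (filter P? ts))
length≤1+filter P? uniq [] [] = z≤n
length≤1+filter P? uniq (t ∷ ts) (t∉ts ∷ u) with P? t
... | yes _ = s≤s (length≤1+filter P? uniq ts u)
... | no ¬p = s≤s (≤-reflexive (cong length (sym (filter-all P? (All.map rest t∉ts)))))
  where
  rest : ∀ {s} → t ≢ s → _
  rest {s} t≢s with P? s
  ... | yes p = p
  ... | no ¬q = contradiction (uniq t s ¬p ¬q) t≢s

-- There are k + 1 candidates 0,...,k, and each of the at most k elements of `xs` excludes at most
-- one.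
pigeonhole : (Bad : X → ℕ → Set) → (∀ x → Decidable (Bad x)) →
             (∀ x s t → Bad x s → Bad x t → s ≡ t) →
             (xs : List X) (k : ℕ) → length xs ≤ k →
             ∃[ t ] (t ≤ k × ∀ x → x ∈ˡ xs → ¬ Bad x t)
pigeonhole {X} Bad Bad? uniq xs k len
  with go xs (upTo (suc k)) (upTo⁺ (suc k))
          (≤-trans (s≤s len) (≤-reflexive (sym (length-upTo (suc k)))))
  where
  go : ∀ xs ts → Unique ts → length xs < length ts →
       ∃[ t ] (t ∈ˡ ts × ∀ x → x ∈ˡ xs → ¬ Bad x t)
  go [] (t ∷ ts) u lt = t , here refl , λ _ ()
  go (x ∷ xs) ts u lt
    with go xs (filter (¬? ∘ Bad? x) ts) (filter⁺ (¬? ∘ Bad? x) u)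
            (≤-pred (<-≤-trans lt (length≤1+filter (¬? ∘ Bad? x)
              (λ s t ¬¬a ¬¬b → uniq x s t (decidable-stable (Bad? x s) ¬¬a)
                                          (decidable-stable (Bad? x t) ¬¬b)) ts u)))
  ... | t , t∈ , good = t , proj₁ (∈-filter⁻ (¬? ∘ Bad? x) t∈) , λ where
    y (here refl) → proj₂ (∈-filter⁻ (¬? ∘ Bad? x) {xs = ts} t∈)
    y (there y∈) → good y y∈
... | t , t∈ , good = t , ≤-pred (∈-upTo⁻ t∈) , good

-- Changing the value of one edge.

infixl 6 _[_≔_]

_[_≔_] : {m : ℕ} → (Fin m → ℕ) → Fin m → ℕ → Fin m → ℕ
ρ [ e ≔ t ] = updateAt ρ e (const t)

≔-same : {m : ℕ} (ρ : Fin m → ℕ) (e : Fin m) (t : ℕ) → (ρ [ e ≔ t ]) e ≡ t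
≔-same ρ e t = updateAt-updates e ρ

≔-other : {m : ℕ} (ρ : Fin m → ℕ) {e f : Fin m} (t : ℕ) → f ≢ e → (ρ [ e ≔ t ]) f ≡ ρ f
≔-other ρ t f≢e = updateAt-minimal _ _ ρ f≢e

private
  ∑ : {m : ℕ} → (Fin m → ℕ) → ℕ
  ∑ = sum +-0-commutativeMonoid

-- The two sums differ by as much as their terms at `e`; the sides are arranged to avoid truncated
-- subtraction, here and in `w-single` and `w-difference`.
∑-update : {m : ℕ} (f g : Fin m → ℕ) (e : Fin m) → (∀ i → i ≢ e → f i ≡ g i) →
           ∑ f + g e ≡ ∑ g + f e
∑-update f g zero eq
  rewrite sum-cong-≗ +-0-commutativeMonoid {x = f ∘ suc} {y = g ∘ suc} (λ i → eq (suc i) λ ())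
  = lemma (f zero) (g zero) (∑ (g ∘ suc))
  where
  lemma : ∀ a b s → a + s + b ≡ b + s + a
  lemma = solve-∀
∑-update f g (suc e) eq rewrite eq zero (λ ()) = begin
  g zero + ∑ (f ∘ suc) + g (suc e)   ≡⟨ +-assoc (g zero) _ _ ⟩
  g zero + (∑ (f ∘ suc) + g (suc e)) ≡⟨ cong (g zero +_) (∑-update (f ∘ suc) (g ∘ suc) e
                                          (λ i i≢e → eq (suc i) (i≢e ∘ suc-injectiveᶠ))) ⟩
  g zero + (∑ (g ∘ suc) + f (suc e)) ≡⟨ +-assoc (g zero) _ _ ⟨
  g zero + ∑ (g ∘ suc) + f (suc e)   ∎
  where open ≡-Reasoning

-- Vertex weights and separating edges.

module Weights {n m : ℕ} (H : Hypergraph n m) where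

  w : (Fin m → ℕ) → Fin n → ℕ
  w = vertexWeight H

  Separates : Fin m → Fin n → Fin n → Set
  Separates e u v = (u ∈ H e × v ∉ H e) ⊎ (v ∈ H e × u ∉ H e)

  separates? : ∀ e u v → Dec (Separates e u v)
  separates? e u v = (u ∈? H e ×-dec ¬? (v ∈? H e)) ⊎-dec (v ∈? H e ×-dec ¬? (u ∈? H e))

  w-cong : ∀ {ρ ρ′} v → (∀ e → v ∈ H e → ρ e ≡ ρ′ e) → w ρ v ≡ w ρ′ v
  w-cong {ρ} {ρ′} v eq = sum-cong-≗ +-0-commutativeMonoid pointwise
    where
    pointwise : ∀ e → (if does (v ∈? H e) then ρ e else 0) ≡ (if does (v ∈? H e) then ρ′ e else 0)
    pointwise e with v ∈? H e
    ... | yes v∈ = eq e v∈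
    ... | no _ = refl

  w-single : ∀ {ρ ρ′ e v} → v ∈ H e → (∀ f → v ∈ H f → f ≢ e → ρ f ≡ ρ′ f) →
             w ρ v + ρ′ e ≡ w ρ′ v + ρ e
  w-single {ρ} {ρ′} {e} {v} v∈ eq = begin
    w ρ v + ρ′ e        ≡⟨ cong (w ρ v +_) (term-in ρ′) ⟨
    w ρ v + term ρ′ e   ≡⟨ ∑-update (term ρ) (term ρ′) e same ⟩
    w ρ′ v + term ρ e   ≡⟨ cong (w ρ′ v +_) (term-in ρ) ⟩
    w ρ′ v + ρ e        ∎
    where
    open ≡-Reasoning
    term : (Fin m → ℕ) → Fin m → ℕ
    term ρ e = if does (v ∈? H e) then ρ e else 0
    term-in : ∀ ρ → term ρ e ≡ ρ e
    term-in ρ with v ∈? H e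
    ... | yes _ = refl
    ... | no v∉ = contradiction v∈ v∉
    same : ∀ f → f ≢ e → term ρ f ≡ term ρ′ f
    same f f≢e with v ∈? H f
    ... | yes v∈f = eq f v∈f f≢e
    ... | no _ = refl

  w-update : ∀ ρ {e v} t → v ∈ H e → w (ρ [ e ≔ t ]) v + ρ e ≡ w ρ v + t
  w-update ρ {e} {v} t v∈ =
    trans (w-single v∈ (λ f _ → ≔-other ρ t)) (cong (w ρ v +_) (≔-same ρ e t))

  w-update-∉ : ∀ ρ {e v} t → v ∉ H e → w (ρ [ e ≔ t ]) v ≡ w ρ v
  w-update-∉ ρ {e} {v} t v∉ = w-cong v λ f v∈ → ≔-other ρ t λ { refl → v∉ v∈ }

  -- An edge containing both or neither of u and v contributes equally to the two sides, so the
  -- difference of the two weights depends only on the separating edges.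
  w-difference : ∀ ρ ρ′ u v → (∀ e → Separates e u v → ρ e ≡ ρ′ e) →
                 w ρ u + w ρ′ v ≡ w ρ′ u + w ρ v
  w-difference ρ ρ′ u v eq = begin
    w ρ u + w ρ′ v   ≡⟨ ∑-distrib-+ M (term ρ u) (term ρ′ v) ⟨
    ∑ (λ e → term ρ u e + term ρ′ v e)  ≡⟨ sum-cong-≗ M pointwise ⟩
    ∑ (λ e → term ρ′ u e + term ρ v e)  ≡⟨ ∑-distrib-+ M (term ρ′ u) (term ρ v) ⟩
    w ρ′ u + w ρ v  ∎
    where
    open ≡-Reasoning
    M = +-0-commutativeMonoid
    term : (Fin m → ℕ) → Fin n → Fin m → ℕ
    term ρ v e = if does (v ∈? H e) then ρ e else 0
    pointwise : ∀ e → term ρ u e + term ρ′ v e ≡ term ρ′ u e + term ρ v e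
    pointwise e with u ∈? H e | v ∈? H e
    ... | yes _ | yes _ = +-comm (ρ e) (ρ′ e)
    ... | yes u∈ | no v∉ = cong (_+ 0) (eq e (inj₁ (u∈ , v∉)))
    ... | no u∉ | yes v∈ = sym (eq e (inj₂ (v∈ , u∉)))
    ... | no _ | no _ = refl

  w-≢ : ∀ {ρ ρ′ u v} → (∀ e → Separates e u v → ρ e ≡ ρ′ e) → w ρ u ≢ w ρ v → w ρ′ u ≢ w ρ′ v
  w-≢ {ρ} {ρ′} {u} {v} eq ρ-≢ ρ′-≡ = ρ-≢ (+-cancelʳ-≡ (w ρ′ v) (w ρ u) (w ρ v) (begin
    w ρ u + w ρ′ v  ≡⟨ w-difference ρ ρ′ u v eq ⟩
    w ρ′ u + w ρ v  ≡⟨ cong (_+ w ρ v) ρ′-≡ ⟩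
    w ρ′ v + w ρ v  ≡⟨ +-comm (w ρ′ v) (w ρ v) ⟩
    w ρ v + w ρ′ v  ∎))
    where open ≡-Reasoning

-- Classes of weights.

-- Writing k = 4i + 2s + b with s, b < 2, the class of k is 2i + b, and k is
-- low when s = 0: a class is a pair {k, k + 2}, and toggling an edge by ±2
-- moves a weight between the two elements of its class.
class : ℕ → ℕ
class 0 = 0
class 1 = 1
class 2 = 0
class 3 = 1
class (suc (suc (suc (suc k)))) = 2 + class k

Low : ℕ → Set
Low 0 = ⊤
Low 1 = ⊤
Low 2 = ⊥
Low 3 = ⊥
Low (suc (suc (suc (suc k)))) = Low k

High : ℕ → Set
High 0 = ⊥
High 1 = ⊥
High 2 = ⊤
High 3 = ⊤
High (suc (suc (suc (suc k)))) = High k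

low⊎high : ∀ k → Low k ⊎ High k
low⊎high 0 = inj₁ tt
low⊎high 1 = inj₁ tt
low⊎high 2 = inj₂ tt
low⊎high 3 = inj₂ tt
low⊎high (suc (suc (suc (suc k)))) = low⊎high k

low∧high : ∀ k → Low k → High k → ⊥
low∧high (suc (suc (suc (suc k)))) = low∧high k

raise-low : ∀ k → Low k → class (2 + k) ≡ class k × High (2 + k)
raise-low 0 _ = refl , tt
raise-low 1 _ = refl , tt
raise-low (suc (suc (suc (suc k)))) l with raise-low k l
... | eq , h = cong (2 +_) eq , h

lower-high : ∀ k → High (2 + k) → class k ≡ class (2 + k) × Low k
lower-high 0 _ = refl , tt
lower-high 1 _ = refl , tt
lower-high (suc (suc (suc (suc k)))) h with lower-high k h
... | eq , l = cong (2 +_) eq , l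

-- The numbers a, a + 2, a + 4, ... repeat classes, while their halves are consecutive. Lowering by
-- one where necessary turns the half into the class and leaves a low number.
class-half : ∀ k → class k ≡ ⌊ k /2⌋ ⊎ ∃[ j ] (k ≡ suc j × class j ≡ ⌊ k /2⌋ × Low j)
class-half 0 = inj₁ refl
class-half 1 = inj₂ (0 , refl , refl , tt)
class-half 2 = inj₂ (1 , refl , refl , tt)
class-half 3 = inj₁ refl
class-half (suc (suc (suc (suc k)))) with class-half k
... | inj₁ eq = inj₁ (cong (2 +_) eq)
... | inj₂ (j , refl , eq , l) = inj₂ (4 + j , refl , cong (2 +_) eq , l)

-- Greedy separation of matched vertices.

module Greedy {n m r : ℕ} (H : Hypergraph n m) (size : ∀ e → ∣ H e ∣ ≤ r)
              (μ : Fin n → Fin n) (μ-involutive : ∀ x → μ (μ x) ≡ x) where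

  open Weights H
  open import Data.List.Membership.DecPropositional (_≟ᶠ_ {m}) using () renaming (_∈?_ to _∈ˡ?_)

  -- A pair with exactly one end in e forbids one value of e, because only that end changes its
  -- weight. Counted by their ends in e, such pairs forbid at most r of the r + 1 values.
  choose : ∀ e ρ → ∃[ t ] (1 ≤ t × t ≤ r + 1 ×
           ∀ u → Separates e u (μ u) → w (ρ [ e ≔ t ]) u ≢ w (ρ [ e ≔ t ]) (μ u))
  choose e ρ with pigeonhole Bad bad? unique (elements (H e)) r
                    (≤-trans (≤-reflexive (length-elements (H e))) (size e))
    where
    Bad : Fin n → ℕ → Set
    Bad y t = (y ∈ H e × μ y ∉ H e) × w (ρ [ e ≔ suc t ]) y ≡ w ρ (μ y)
    bad? : ∀ y t → Dec (Bad y t)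
    bad? y t = (y ∈? H e ×-dec ¬? (μ y ∈? H e)) ×-dec (w (ρ [ e ≔ suc t ]) y ≟ w ρ (μ y))
    unique : ∀ y s t → Bad y s → Bad y t → s ≡ t
    unique y s t ((y∈ , _) , p) (_ , q) =
      suc-injective (+-cancelˡ-≡ (w ρ y) _ _ (trans (sym (w-update ρ (suc s) y∈))
        (trans (cong (_+ ρ e) (trans p (sym q))) (w-update ρ (suc t) y∈))))
  ... | t , t≤r , good = suc t , s≤s z≤n , ≤-trans (s≤s t≤r) (≤-reflexive (+-comm 1 r)) , differ
    where
    differ : ∀ u → Separates e u (μ u) → w (ρ [ e ≔ suc t ]) u ≢ w (ρ [ e ≔ suc t ]) (μ u)
    differ u (inj₁ (u∈ , μu∉)) eq =
      good u (∈-elements⁺ (H e) u∈) ((u∈ , μu∉) , trans eq (w-update-∉ ρ (suc t) μu∉))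
    differ u (inj₂ (μu∈ , u∉)) eq =
      good (μ u) (∈-elements⁺ (H e) μu∈)
        ((μu∈ , λ i → u∉ (subst (_∈ H e) (μ-involutive u) i)) ,
         trans (sym eq) (trans (w-update-∉ ρ (suc t) u∉) (cong (w ρ) (sym (μ-involutive u)))))

  abstract
    -- A pair becomes different at each edge that separates it and stays different under the edges
    -- that do not. Hence one separating edge in the list, or a difference at the start, is enough.
    greedy : (T : Subset n) (es : List (Fin m)) (ρ : Fin m → ℕ) →
             (∀ u → u ∈ T → ∃[ e ] (e ∈ˡ es × Separates e u (μ u)) ⊎ w ρ u ≢ w ρ (μ u)) →
             ∃[ ρ′ ] ((∀ e → e ∉ˡ es → ρ′ e ≡ ρ e) × (∀ e → e ∈ˡ es → 1 ≤ ρ′ e × ρ′ e ≤ r + 1) ×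
                      (∀ u → u ∈ T → w ρ′ u ≢ w ρ′ (μ u)))
    greedy T [] ρ sep = ρ , (λ _ _ → refl) , (λ _ ()) , λ u u∈ → differ (sep u u∈)
      where
      differ : ∀ {u} → ∃[ e ] (e ∈ˡ [] × Separates e u (μ u)) ⊎ w ρ u ≢ w ρ (μ u) →
               w ρ u ≢ w ρ (μ u)
      differ (inj₂ d) = d
    greedy T (e ∷ es) ρ sep with choose e ρ
    ... | t , 1≤t , t≤ , good with greedy T es (ρ [ e ≔ t ]) sep′
      where
      sep′ : ∀ u → u ∈ T → ∃[ f ] (f ∈ˡ es × Separates f u (μ u)) ⊎
                           w (ρ [ e ≔ t ]) u ≢ w (ρ [ e ≔ t ]) (μ u)
      sep′ u u∈ with separates? e u (μ u)
      ... | yes s = inj₂ (good u s)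
      ... | no ¬s with sep u u∈
      ... | inj₁ (f , here refl , s) = contradiction s ¬s
      ... | inj₁ (f , there f∈ , s) = inj₁ (f , f∈ , s)
      ... | inj₂ d = inj₂ (w-≢ (λ f s → sym (≔-other ρ t λ { refl → ¬s s })) d)
    ... | ρ′ , same , range , differ = ρ′ , same′ , range′ , differ
      where
      same′ : ∀ f → f ∉ˡ e ∷ es → ρ′ f ≡ ρ f
      same′ f f∉ = trans (same f (λ f∈ → f∉ (there f∈))) (≔-other ρ t λ { refl → f∉ (here refl) })
      range′ : ∀ f → f ∈ˡ e ∷ es → 1 ≤ ρ′ f × ρ′ f ≤ r + 1
      range′ f f∈ with f ∈ˡ? es
      range′ f f∈ | yes f∈es = range f f∈es
      range′ f (here refl) | no f∉ rewrite same f f∉ | ≔-same ρ f t = 1≤t , t≤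
      range′ f (there f∈) | no f∉ = contradiction f∈ f∉

-- Shifting three pairs of numbers apart.

-- Three pairs of numbers can be shifted by amounts in {1,…,5} so that they
-- become pairwise disjoint.  This is an instance of the Combinatorial
-- Nullstellensatz: the coefficient of x⁴y⁴z⁴ in (x-y)⁴(y-z)⁴(z-x)⁴ is 90 ≠ 0.
-- It is checked here by search: any two of the shifts have at most four
-- forbidden differences, and however these are placed some triple survives.
module Triples where

  Triple : Set
  Triple = ℕ × ℕ × ℕ

  p₁ p₂ p₃ : Triple → ℕ
  p₁ (a , _ , _) = a
  p₂ (_ , b , _) = b
  p₃ (_ , _ , c) = c

  Forbids : ℕ × ℕ → ℕ → ℕ → Set
  Forbids (a , b) s t = a + s ≡ b + t

  forbids? : ∀ c s t → Dec (Forbids c s t)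
  forbids? (a , b) s t = a + s ≟ b + t

  keep? : ∀ (p q : Triple → ℕ) (x y : Triple) → Dec (¬ (p x + q y ≡ q x + p y))
  keep? p q x y = ¬? (p x + q y ≟ q x + p y)

  keep : (p q : Triple → ℕ) → Triple → List Triple → List Triple
  keep p q x = filter (keep? p q x)

  -- The game tree of the search: i, j, k bound the forbidden differences not yet placed between the
  -- first and second, first and third, second and third shift. One of them must hit x to rule it
  -- out, and placing it deletes every triple with the same difference. With none left of a kind,
  -- that branch cannot occur.
  survives : ℕ → ℕ → ℕ → List Triple → Bool
  survives₁ survives₂ survives₃ : ℕ → ℕ → ℕ → Triple → List Triple → Bool
  survives i j k [] = false
  survives i j k (x ∷ xs) = survives₁ i j k x xs ∧ survives₂ i j k x xs ∧ survives₃ i j k x xs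
  survives₁ zero    j k x xs = true
  survives₁ (suc i) j k x xs = survives i j k (keep p₁ p₂ x xs)
  survives₂ i zero    k x xs = true
  survives₂ i (suc j) k x xs = survives i j k (keep p₁ p₃ x xs)
  survives₃ i j zero    x xs = true
  survives₃ i j (suc k) x xs = survives i j k (keep p₂ p₃ x xs)

  -- Shifting all three by the same amount changes nothing, so one of the
  -- shifts may be taken to be 1.
  candidates : List Triple
  candidates = filter (λ t → p₁ t ⊓ p₂ t ⊓ p₃ t ≟ 1)
    (concatMap (λ a → concatMap (λ b → map (λ c → a , b , c) shifts) shifts) shifts)
    where
    shifts : List ℕ
    shifts = 1 ∷ 5 ∷ 2 ∷ 4 ∷ 3 ∷ []

  candidates-survive : survives 4 4 4 candidates ≡ true
  candidates-survive = refl

  forbids-difference : ∀ c {s t s′ t′} → Forbids c s t → Forbids c s′ t′ → s + t′ ≡ t + s′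
  forbids-difference (a , b) {s} {t} {s′} {t′} p q = +-cancelˡ-≡ (a + b) _ _ (begin
    (a + b) + (s + t′)  ≡⟨ rearrange a b s t′ ⟩
    (a + s) + (b + t′)  ≡⟨ cong₂ _+_ p (sym q) ⟩
    (b + t) + (a + s′)  ≡⟨ rearrange b a t s′ ⟨
    (b + a) + (t + s′)  ≡⟨ cong (_+ (t + s′)) (+-comm b a) ⟩
    (a + b) + (t + s′)  ∎)
    where
    open ≡-Reasoning
    rearrange : ∀ a b s t → (a + b) + (s + t) ≡ (a + s) + (b + t)
    rearrange = solve-∀

  Free : (p q : Triple → ℕ) → List (ℕ × ℕ) → Triple → Set
  Free p q cs t = ∀ c → c ∈ˡ cs → ¬ Forbids c (p t) (q t)

  module _ (p q : Triple → ℕ) (x : Triple) where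

    remaining : List (ℕ × ℕ) → List (ℕ × ℕ)
    remaining = filter (λ c → ¬? (forbids? c (p x) (q x)))

    length-remaining : ∀ {k} cs → Any (λ c → Forbids c (p x) (q x)) cs → length cs ≤ suc k →
                       length (remaining cs) ≤ k
    length-remaining cs hit len =
      ≤-pred (≤-trans (filter-notAll _ cs (Any.map (λ h ¬h → ¬h h) hit)) len)

    free-remaining : ∀ cs xs {t} → t ∈ˡ keep p q x xs → Free p q (remaining cs) t → Free p q cs t
    free-remaining cs xs {t} t∈ free c c∈ f with forbids? c (p x) (q x)
    ... | yes f₀ = proj₂ (∈-filter⁻ (keep? p q x) {xs = xs} t∈) (forbids-difference c f₀ f)
    ... | no ¬f₀ = free c (∈-filter⁺ _ c∈ ¬f₀) f

    kept : ∀ xs {t} → t ∈ˡ keep p q x xs → t ∈ˡ x ∷ xs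
    kept xs t∈ = there (proj₁ (∈-filter⁻ (keep? p q x) {xs = xs} t∈))

  Good : (as bs cs : List (ℕ × ℕ)) → Triple → Set
  Good as bs cs t = Free p₁ p₂ as t × Free p₁ p₃ bs t × Free p₂ p₃ cs t

  -- Follows `survives`: a constraint violated by the first triple pays for one branch, and if there
  -- is none this triple is the answer.
  search : ∀ i j k xs as bs cs → length as ≤ i → length bs ≤ j → length cs ≤ k →
           survives i j k xs ≡ true → ∃[ t ] (t ∈ˡ xs × Good as bs cs t)
  search₁ : ∀ i j k x xs as bs cs → length as ≤ i → length bs ≤ j → length cs ≤ k →
            Any (λ c → Forbids c (p₁ x) (p₂ x)) as →
            survives₁ i j k x xs ≡ true → ∃[ t ] (t ∈ˡ x ∷ xs × Good as bs cs t)
  search₂ : ∀ i j k x xs as bs cs → length as ≤ i → length bs ≤ j → length cs ≤ k →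
            Any (λ c → Forbids c (p₁ x) (p₃ x)) bs →
            survives₂ i j k x xs ≡ true → ∃[ t ] (t ∈ˡ x ∷ xs × Good as bs cs t)
  search₃ : ∀ i j k x xs as bs cs → length as ≤ i → length bs ≤ j → length cs ≤ k →
            Any (λ c → Forbids c (p₂ x) (p₃ x)) cs →
            survives₃ i j k x xs ≡ true → ∃[ t ] (t ∈ˡ x ∷ xs × Good as bs cs t)

  search i j k (x ∷ xs) as bs cs la lb lc ok
    with ∧-true ok
    where
    ∧-true : ∀ {a b c} → a ∧ b ∧ c ≡ true → a ≡ true × b ≡ true × c ≡ true
    ∧-true {true} {true} {true} refl = refl , refl , refl
  ... | ok₁ , ok₂ , ok₃
    with Any.any? (λ c → forbids? c (p₁ x) (p₂ x)) as
       | Any.any? (λ c → forbids? c (p₁ x) (p₃ x)) bs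
       | Any.any? (λ c → forbids? c (p₂ x) (p₃ x)) cs
  ... | yes hit | _ | _ = search₁ i j k x xs as bs cs la lb lc hit ok₁
  ... | no _ | yes hit | _ = search₂ i j k x xs as bs cs la lb lc hit ok₂
  ... | no _ | no _ | yes hit = search₃ i j k x xs as bs cs la lb lc hit ok₃
  ... | no a | no b | no c = x , here refl , free p₁ p₂ a , free p₁ p₃ b , free p₂ p₃ c
    where
    free : ∀ p q {ds : List (ℕ × ℕ)} → ¬ Any (λ c → Forbids c (p x) (q x)) ds → Free p q ds x
    free p q ¬hit c c∈ f = ¬hit (lose c∈ f)

  search₁ zero j k x xs (_ ∷ _) bs cs () lb lc hit ok
  search₁ (suc i) j k x xs as bs cs la lb lc hit ok
    with search i j k (keep p₁ p₂ x xs) (remaining p₁ p₂ x as) bs cs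
           (length-remaining p₁ p₂ x as hit la) lb lc ok
  ... | t , t∈ , a , b , c = t , kept p₁ p₂ x xs t∈ , free-remaining p₁ p₂ x as xs t∈ a , b , c

  search₂ i zero k x xs as (_ ∷ _) cs la () lc hit ok
  search₂ i (suc j) k x xs as bs cs la lb lc hit ok
    with search i j k (keep p₁ p₃ x xs) as (remaining p₁ p₃ x bs) cs la
           (length-remaining p₁ p₃ x bs hit lb) lc ok
  ... | t , t∈ , a , b , c = t , kept p₁ p₃ x xs t∈ , a , free-remaining p₁ p₃ x bs xs t∈ b , c

  search₃ i j zero x xs as bs (_ ∷ _) la lb () hit ok
  search₃ i j (suc k) x xs as bs cs la lb lc hit ok
    with search i j k (keep p₂ p₃ x xs) as bs (remaining p₂ p₃ x cs) la lb
           (length-remaining p₂ p₃ x cs hit lc) ok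
  ... | t , t∈ , a , b , c = t , kept p₂ p₃ x xs t∈ , a , b , free-remaining p₂ p₃ x cs xs t∈ c

  InRange : Triple → Set
  InRange t = (1 ≤ p₁ t × p₁ t ≤ 5) × (1 ≤ p₂ t × p₂ t ≤ 5) × (1 ≤ p₃ t × p₃ t ≤ 5)

  inRange? : ∀ t → Dec (InRange t)
  inRange? t = (1 ≤? p₁ t ×-dec p₁ t ≤? 5) ×-dec
    (1 ≤? p₂ t ×-dec p₂ t ≤? 5) ×-dec (1 ≤? p₃ t ×-dec p₃ t ≤? 5)

  abstract
    shift-apart : (as bs cs : List (ℕ × ℕ)) → length as ≤ 4 → length bs ≤ 4 → length cs ≤ 4 →
                  ∃[ t ] (InRange t × Good as bs cs t)
    shift-apart as bs cs la lb lc =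
      from candidates candidates-survive (toWitness {a? = All.all? inRange? candidates} _)
      where
      from : ∀ xs → survives 4 4 4 xs ≡ true → All InRange xs → ∃[ t ] (InRange t × Good as bs cs t)
      from xs ok range with search 4 4 4 xs as bs cs la lb lc ok
      ... | t , t∈ , good = t , All.lookup range t∈ , good

-- The number a + 2k, accumulated in `a` so as to unfold along with the successive steps of `raise`.
up : ℕ → ℕ → ℕ
up zero a = a
up (suc k) a = up k (2 + a)

half-up : ∀ k a → ⌊ up k a /2⌋ ≡ k + ⌊ a /2⌋
half-up zero a = refl
half-up (suc k) a = trans (half-up k (2 + a)) (+-suc k ⌊ a /2⌋)

-- Traces of edges on a vertex set, and partial solutions.

module Traces {n m : ℕ} (H : Hypergraph n m) where

  open Weights H

  Avoids : Subset n → Fin m → Set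
  Avoids C e = ∀ y → y ∈ C → y ∉ H e

  Only : Subset n → Fin m → Fin n → Set
  Only C e p = (p ∈ H e × p ∈ C) × ∀ y → y ∈ C → y ∈ H e → y ≡ p

  Two : Subset n → Fin m → Set
  Two C e = ∃[ u ] ∃[ v ] (u ≢ v × (u ∈ H e × u ∈ C) × (v ∈ H e × v ∈ C))

  avoids? : ∀ C e → Dec (Avoids C e)
  avoids? C e = all? (λ y → (y ∈? C) →-dec ¬? (y ∈? H e))

  only? : ∀ C e p → Dec (Only C e p)
  only? C e p = (p ∈? H e ×-dec p ∈? C) ×-dec all? (λ y → (y ∈? C) →-dec (y ∈? H e) →-dec (y ≟ᶠ p))

  two? : ∀ C e → Dec (Two C e)
  two? C e = any? λ u → any? λ v →
    ¬? (u ≟ᶠ v) ×-dec (u ∈? H e ×-dec u ∈? C) ×-dec (v ∈? H e ×-dec v ∈? C)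

  data Trace (C : Subset n) (e : Fin m) : Set where
    avoids : Avoids C e → Trace C e
    only   : ∀ p → Only C e p → Trace C e
    two    : Two C e → Trace C e

  ¬two⇒only : ∀ {C e p} → ¬ Two C e → p ∈ H e → p ∈ C → Only C e p
  ¬two⇒only {p = p} ¬2 p∈e p∈C = (p∈e , p∈C) , same
    where
    same : ∀ y → y ∈ _ → y ∈ H _ → y ≡ p
    same y y∈C y∈e with y ≟ᶠ p
    ... | yes eq = eq
    ... | no ne = contradiction (y , p , ne , (y∈e , y∈C) , (p∈e , p∈C)) ¬2

  trace : ∀ C e → Trace C e
  trace C e with two? C e
  ... | yes t = two t
  ... | no ¬2 with any? (λ p → p ∈? H e ×-dec p ∈? C)
  ... | yes (p , p∈e , p∈C) = only p (¬two⇒only ¬2 p∈e p∈C)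
  ... | no none = avoids (λ y y∈C y∈e → none (y , y∈e , y∈C))

  two-mono : ∀ {C D e} → C ⊆ D → Two C e → Two D e
  two-mono C⊆D (u , v , ne , (ue , uC) , (ve , vC)) = u , v , ne , (ue , C⊆D uC) , (ve , C⊆D vC)

  only-¬two : ∀ {C e p} → Only C e p → ¬ Two C e
  only-¬two (_ , same) (u , v , ne , (ue , uC) , (ve , vC)) =
    ne (trans (same u uC ue) (sym (same v vC ve)))

  avoids-¬two : ∀ {C e} → Avoids C e → ¬ Two C e
  avoids-¬two av (u , _ , _ , (ue , uC) , _) = av u uC ue

  w-raise : ∀ {ρ e v} → v ∈ H e → w (ρ [ e ≔ 2 + ρ e ]) v ≡ 2 + w ρ v
  w-raise {ρ} {e} {v} v∈ = +-cancelʳ-≡ (ρ e) _ _ (begin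
    w (ρ [ e ≔ 2 + ρ e ]) v + ρ e  ≡⟨ w-update ρ (2 + ρ e) v∈ ⟩
    w ρ v + (2 + ρ e)              ≡⟨ +-assoc (w ρ v) 2 (ρ e) ⟨
    w ρ v + 2 + ρ e                ≡⟨ cong (_+ ρ e) (+-comm (w ρ v) 2) ⟩
    2 + w ρ v + ρ e                ∎)
    where open ≡-Reasoning

  w-lower : ∀ {ρ e v} k t → ρ e ≡ k + t → v ∈ H e → w ρ v ≡ k + w (ρ [ e ≔ t ]) v
  w-lower {ρ} {e} {v} k t eq v∈ = +-cancelʳ-≡ t _ _ (begin
    w ρ v + t                    ≡⟨ w-update ρ t v∈ ⟨
    w (ρ [ e ≔ t ]) v + ρ e      ≡⟨ cong (w (ρ [ e ≔ t ]) v +_) eq ⟩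
    w (ρ [ e ≔ t ]) v + (k + t)  ≡⟨ +-assoc (w (ρ [ e ≔ t ]) v) k t ⟨
    w (ρ [ e ≔ t ]) v + k + t    ≡⟨ cong (_+ t) (+-comm (w (ρ [ e ≔ t ]) v) k) ⟩
    k + w (ρ [ e ≔ t ]) v + t    ∎)
    where open ≡-Reasoning

  Bichromatic : Subset n → (Fin m → ℕ) → Fin m → Set
  Bichromatic M ρ e = ∃[ u ] ∃[ v ] ((u ∈ H e × u ∈ M) × (v ∈ H e × v ∈ M) × w ρ u ≢ w ρ v)

  -- `B` is the set of edges whose values are free. Both witnesses are required in `M`, so that
  -- later changes to edges missing `M` do not spoil them.
  record Solution (R : ℕ) (ρ₀ : Fin m → ℕ) (M : Subset n) (B : Subset m) : Set where
    field
      ρ           : Fin m → ℕ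
      unchanged     : ∀ e → e ∉ B → ρ e ≡ ρ₀ e
      range       : ∀ e → e ∈ B → 1 ≤ ρ e × ρ e ≤ R
      bichromatic : ∀ e → e ∈ B → Bichromatic M ρ e

-- Raising and lowering edges between processed vertices and the next one.

module Toggling {n m : ℕ} (H : Hypergraph n m) (A : Subset m) (C : Subset n) (q : Fin n) where

  open Weights H
  open Traces H

  Open : Fin m → Fin n → Set
  Open e p = e ∈ A × Only C e p

  -- An open edge at p that contains q plays the graph edge joining p and q; the hot vertices are
  -- the earlier neighbours of q in this graph.
  Hot : Fin n → Set
  Hot p = ∃[ e ] (Open e p × q ∈ H e)

  hot? : ∀ p → Dec (Hot p)
  hot? p = any? λ e → (e ∈? A ×-dec only? C e p) ×-dec q ∈? H e

  hot∈ : ∀ {p} → Hot p → p ∈ C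
  hot∈ (_ , (_ , (_ , p∈C) , _) , _) = p∈C

  -- `T` is `Met` while edges are toggled, and is relaxed to `¬ Two C e` when an edge avoiding C is
  -- changed too.
  record Moved (T : Fin m → Set) (ρ ρ′ : Fin m → ℕ) : Set where
    constructor moved
    field
      edges   : ∀ e → ρ′ e ≡ ρ e ⊎ ((e ∈ A × q ∈ H e × T e) × (1 ≤ ρ′ e × ρ′ e ≤ 5))
      classes : ∀ p → p ∈ C → class (w ρ′ p) ≡ class (w ρ p)

  open Moved public

  Met : Fin m → Set
  Met e = ∃[ p ] Only C e p

  Toggled : (ρ ρ′ : Fin m → ℕ) → Set
  Toggled = Moved Met

  moved-refl : ∀ {T ρ} → Moved T ρ ρ
  moved-refl = moved (λ _ → inj₁ refl) (λ _ _ → refl)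

  moved-trans : ∀ {T ρ ρ′ ρ″} → Moved T ρ ρ′ → Moved T ρ′ ρ″ → Moved T ρ ρ″
  moved-trans {T} {ρ} {ρ′} {ρ″} a b = moved edges″ λ p p∈ → trans (classes b p p∈) (classes a p p∈)
    where
    edges″ : ∀ e → ρ″ e ≡ ρ e ⊎ ((e ∈ A × q ∈ H e × T e) × (1 ≤ ρ″ e × ρ″ e ≤ 5))
    edges″ e with edges b e | edges a e
    ... | inj₂ c | _ = inj₂ c
    ... | inj₁ eq | inj₁ eq′ = inj₁ (trans eq eq′)
    ... | inj₁ eq | inj₂ (c , r) rewrite eq = inj₂ (c , r)

  toggled⇒moved : ∀ {ρ ρ′} → Toggled ρ ρ′ → Moved (λ e → ¬ Two C e) ρ ρ′
  toggled⇒moved {ρ} {ρ′} mv = moved edges′ (classes mv)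
    where
    edges′ : ∀ e → ρ′ e ≡ ρ e ⊎ ((e ∈ A × q ∈ H e × ¬ Two C e) × (1 ≤ ρ′ e × ρ′ e ≤ 5))
    edges′ e with edges mv e
    ... | inj₁ eq = inj₁ eq
    ... | inj₂ ((e∈ , q∈ , _ , o) , r) = inj₂ ((e∈ , q∈ , only-¬two o) , r)

  -- The edge can be raised by 2 within the bound 5 and without p leaving its class. A high vertex
  -- that is `Able` first lowers an edge from 3 to 1, which makes it ready.
  Ready : (Fin m → ℕ) → Fin n → Set
  Ready ρ p = ∃[ e ] (Open e p × q ∈ H e × ρ e ≤ 3 × Low (w ρ p))

  Able : (Fin m → ℕ) → Fin n → Set
  Able ρ p = Ready ρ p ⊎ ∃[ e ] (Open e p × q ∈ H e × ρ e ≡ 3 × High (w ρ p))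

  module _ {ρ : Fin m → ℕ} {g p} (op : Open g p) (t : ℕ) where

    w-other : ∀ {x} → x ∈ C → x ≢ p → w (ρ [ g ≔ t ]) x ≡ w ρ x
    w-other x∈C x≢p = w-update-∉ ρ t λ x∈g → x≢p (proj₂ (proj₂ op) _ x∈C x∈g)

    edge-other : ∀ {e x} → Open e x → x ≢ p → (ρ [ g ≔ t ]) e ≡ ρ e
    edge-other {e} {x} (_ , (x∈e , x∈C) , _) x≢p =
      ≔-other ρ t λ { refl → x≢p (proj₂ (proj₂ op) x x∈C x∈e) }

    move : q ∈ H g → 1 ≤ t → t ≤ 5 → class (w (ρ [ g ≔ t ]) p) ≡ class (w ρ p) →
           Toggled ρ (ρ [ g ≔ t ])
    move q∈g 1≤t t≤5 cl = moved edges′ classes′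
      where
      edges′ : ∀ e → (ρ [ g ≔ t ]) e ≡ ρ e ⊎
               ((e ∈ A × q ∈ H e × Met e) × (1 ≤ (ρ [ g ≔ t ]) e × (ρ [ g ≔ t ]) e ≤ 5))
      edges′ e with e ≟ᶠ g
      ... | no ne = inj₁ (≔-other ρ t ne)
      ... | yes refl rewrite ≔-same ρ g t =
        inj₂ ((proj₁ op , q∈g , p , proj₂ op) , 1≤t , t≤5)
      classes′ : ∀ x → x ∈ C → class (w (ρ [ g ≔ t ]) x) ≡ class (w ρ x)
      classes′ x x∈C with x ≟ᶠ p
      ... | yes refl = cl
      ... | no ne = cong class (w-other x∈C ne)

    ready-other : ∀ {x} → x ≢ p → Ready ρ x → Ready (ρ [ g ≔ t ]) x
    ready-other x≢p (e , o , q∈e , le , low)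
      rewrite sym (edge-other o x≢p) | sym (w-other (proj₂ (proj₁ (proj₂ o))) x≢p)
      = e , o , q∈e , le , low

    able-other : ∀ {x} → x ≢ p → Able ρ x → Able (ρ [ g ≔ t ]) x
    able-other x≢p (inj₁ r) = inj₁ (ready-other x≢p r)
    able-other x≢p (inj₂ (e , o , q∈e , eq , high))
      rewrite sym (edge-other o x≢p) | sym (w-other (proj₂ (proj₁ (proj₂ o))) x≢p)
      = inj₂ (e , o , q∈e , eq , high)

  lower-one : ∀ {ρ p} → Able ρ p → ∃[ ρ′ ] (Toggled ρ ρ′ × Ready ρ′ p ×
              (∀ x → Ready ρ x → Ready ρ′ x) × (∀ x → Able ρ x → Able ρ′ x))
  lower-one {ρ} (inj₁ r) = ρ , moved-refl , r , (λ _ r → r) , (λ _ a → a)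
  lower-one {ρ} {p} (inj₂ (g , o , q∈g , eq , high)) =
    ρ [ g ≔ 1 ] , move o 1 q∈g (s≤s z≤n) (s≤s z≤n) (trans (proj₁ lowered) (cong class (sym drop))) ,
    ready , (λ x r → by-cases x λ ne → ready-other o 1 ne r) , able
    where
    drop : w ρ p ≡ 2 + w (ρ [ g ≔ 1 ]) p
    drop = w-lower 2 1 eq (proj₁ (proj₁ (proj₂ o)))
    lowered : class (w (ρ [ g ≔ 1 ]) p) ≡ class (2 + w (ρ [ g ≔ 1 ]) p) × Low (w (ρ [ g ≔ 1 ]) p)
    lowered = lower-high (w (ρ [ g ≔ 1 ]) p) (subst High drop high)
    ready : Ready (ρ [ g ≔ 1 ]) p
    ready = g , o , q∈g , subst (_≤ 3) (sym (≔-same ρ g 1)) (s≤s z≤n) , proj₂ lowered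
    by-cases : ∀ x → (x ≢ p → Ready (ρ [ g ≔ 1 ]) x) → Ready (ρ [ g ≔ 1 ]) x
    by-cases x f with x ≟ᶠ p
    ... | yes refl = ready
    ... | no ne = f ne
    able : ∀ x → Able ρ x → Able (ρ [ g ≔ 1 ]) x
    able x a with x ≟ᶠ p
    ... | yes refl = inj₁ ready
    ... | no ne = able-other o 1 ne a

  lower : ∀ ρ ps → (∀ p → p ∈ˡ ps → Able ρ p) →
          ∃[ ρ′ ] (Toggled ρ ρ′ × (∀ p → p ∈ˡ ps → Ready ρ′ p) × (∀ x → Ready ρ x → Ready ρ′ x))
  lower ρ [] able = ρ , moved-refl , (λ _ ()) , (λ _ r → r)
  lower ρ (p ∷ ps) able with lower-one (able p (here refl))
  ... | ρ₁ , mv₁ , r₁ , keep₁ , able₁ with lower ρ₁ ps (λ x x∈ → able₁ x (able x (there x∈)))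
  ... | ρ₂ , mv₂ , r₂ , keep₂ = ρ₂ , moved-trans mv₁ mv₂ ,
    (λ { x (here refl) → keep₂ x r₁ ; x (there x∈) → r₂ x x∈ }) , λ x r → keep₂ x (keep₁ x r)

  -- An open edge has just one vertex in C, so raising for one hot vertex leaves the others as they
  -- are, while each raise adds 2 at q.
  raise : ∀ ρ ps → Unique ps → (∀ p → p ∈ˡ ps → Ready ρ p) →
          ∃[ ρ′ ] (Toggled ρ ρ′ × w ρ′ q ≡ up (length ps) (w ρ q) ×
                   (∀ x → x ∈ C → x ∈ˡ ps → w ρ′ x ≡ 2 + w ρ x) ×
                   (∀ x → x ∈ C → x ∉ˡ ps → w ρ′ x ≡ w ρ x))
  raise ρ [] u ready = ρ , moved-refl , refl , (λ _ _ ()) , λ _ _ _ → refl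
  raise ρ (p ∷ ps) (p∉ ∷ u) ready with ready p (here refl)
  ... | g , o , q∈g , ≤3 , low
    with raise (ρ [ g ≔ 2 + ρ g ]) ps u
           (λ x x∈ → ready-other o (2 + ρ g) (λ { refl → All.lookup p∉ x∈ refl })
                                            (ready x (there x∈)))
  ... | ρ′ , mv , wq , ins , outs = ρ′ , moved-trans first mv ,
    trans wq (cong (up (length ps)) (w-raise q∈g)) , ins′ , outs′
    where
    p∈g : p ∈ H g
    p∈g = proj₁ (proj₁ (proj₂ o))
    first : Toggled ρ (ρ [ g ≔ 2 + ρ g ])
    first = move o (2 + ρ g) q∈g (s≤s z≤n) (s≤s (s≤s ≤3))
              (trans (cong class (w-raise p∈g)) (proj₁ (raise-low (w ρ p) low)))
    p∉ˡ : p ∉ˡ ps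
    p∉ˡ p∈ = All.lookup p∉ p∈ refl
    ins′ : ∀ x → x ∈ C → x ∈ˡ p ∷ ps → w ρ′ x ≡ 2 + w ρ x
    ins′ x x∈C (here refl) = trans (outs x x∈C p∉ˡ) (w-raise p∈g)
    ins′ x x∈C (there x∈) =
      trans (ins x x∈C x∈) (cong (2 +_) (w-other o _ x∈C λ { refl → p∉ˡ x∈ }))
    outs′ : ∀ x → x ∈ C → x ∉ˡ p ∷ ps → w ρ′ x ≡ w ρ x
    outs′ x x∈C x∉ = trans (outs x x∈C (x∉ ∘ there)) (w-other o _ x∈C λ { refl → x∉ (here refl) })

  hots : List (Fin n)
  hots = filter hot? (allFin n)

  ∈-hots⁺ : ∀ {p} → Hot p → p ∈ˡ hots
  ∈-hots⁺ h = ∈-filter⁺ hot? (∈-allFin _) h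

  ∈-hots⁻ : ∀ {p} → p ∈ˡ hots → Hot p
  ∈-hots⁻ p∈ = proj₂ (∈-filter⁻ hot? {xs = allFin n} p∈)

  unique-hots : Unique hots
  unique-hots = filter⁺ hot? (allFin⁺ n)

-- The algorithm of Kalkowski, Karoński and Pfender.

module Block {n m : ℕ} (H : Hypergraph n m) (A : Subset m) (ρ₀ : Fin m → ℕ)
             (R : ℕ) (5≤R : 5 ≤ R) where

  open Weights H
  open Traces H

  Opened : Subset n → Fin m → Fin n → Set
  Opened C e p = e ∈ A × Only C e p

  -- For an edge with one processed vertex, the waiting time until its second one is processed.
  depth : Fin m → List (Fin n) → ℕ
  depth e [] = 0
  depth e (y ∷ ys) = if does (y ∈? H e) then 0 else suc (depth e ys)

  depth-∈ : ∀ {e y} ys → y ∈ H e → depth e (y ∷ ys) ≡ 0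
  depth-∈ {e} {y} ys y∈ with y ∈? H e
  ... | yes _ = refl
  ... | no y∉ = contradiction y∈ y∉

  depth-∉ : ∀ {e y} ys → y ∉ H e → depth e (y ∷ ys) ≡ suc (depth e ys)
  depth-∉ {e} {y} ys y∉ with y ∈? H e
  ... | yes y∈ = contradiction y∈ y∉
  ... | no _ = refl

  depth-first : ∀ {s e y} ys → depth s (y ∷ ys) ≤ depth e (y ∷ ys) → y ∈ H e → y ∈ H s
  depth-first {s} {y = y} ys le y∈e with y ∈? H s
  ... | yes y∈s = y∈s
  ... | no _ with subst (_ ≤_) (depth-∈ ys y∈e) le
  ... | ()

  depth-rest : ∀ {s e y} ys → depth s (y ∷ ys) ≤ depth e (y ∷ ys) → y ∉ H s → y ∉ H e →
               depth s ys ≤ depth e ys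
  depth-rest ys le y∉s y∉e rewrite depth-∉ ys y∉s | depth-∉ ys y∉e = ≤-pred le

  -- The open edges at a processed vertex have value 3, except possibly for
  -- one edge of value 2.  The latter can only be raised, so it must be used
  -- first: its second vertex is the earliest one among the open edges.
  data Tension (C : Subset n) (ys : List (Fin n)) (ρ : Fin m → ℕ) (p : Fin n) : Set where
    calm  : (∀ e → Opened C e p → ρ e ≡ 3) → Tension C ys ρ p
    tense : ∀ s → Opened C s p → ρ s ≡ 2 → Low (w ρ p) →
            (∀ e → Opened C e p → e ≢ s → ρ e ≡ 3) →
            (∀ e → Opened C e p → depth s ys ≤ depth e ys) → Tension C ys ρ p

  -- Different classes survive all later toggling, which preserves the class of every processed
  -- vertex; in Z the weights themselves are final.
  Settled : Subset n → Subset n → (Fin m → ℕ) → Fin m → Set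
  Settled Z C ρ e = ∃[ u ] ∃[ v ] ((u ∈ H e × u ∈ C) × (v ∈ H e × v ∈ C) ×
    (class (w ρ u) ≢ class (w ρ v) ⊎ (u ∈ Z × v ∈ Z × w ρ u ≢ w ρ v)))

  -- C is the set of processed vertices, ys the list of the remaining ones,
  -- and Z ⊆ C the set of those whose weights are final.
  record State (C : Subset n) (ys : List (Fin n)) : Set where
    field
      ρ         : Fin m → ℕ
      Z         : Subset n
      Z⊆C       : Z ⊆ C
      closed    : ∀ e → e ∈ A → ∀ z → z ∈ Z → z ∈ H e → Two Z e
      untouched : ∀ e → e ∈ A → Avoids C e → ρ e ≡ 3
      settled   : ∀ e → e ∈ A → Two C e → Settled Z C ρ e
      tension   : ∀ p → p ∈ C → Tension C ys ρ p
      unchanged   : ∀ e → e ∉ A → ρ e ≡ ρ₀ e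
      range     : ∀ e → e ∈ A → 1 ≤ ρ e × ρ e ≤ R

  module Step {C : Subset n} {q : Fin n} {ys : List (Fin n)} (S : State C (q ∷ ys)) where

    open State S
    open Toggling H A C q

    -- A tense vertex raises its edge of value 2, which contains q because no open edge at p reaches
    -- its second vertex sooner. A calm one has an edge of value 3, to be raised if p is low and
    -- lowered first if p is high.
    able : ∀ {p} → Hot p → Able ρ p
    able {p} (e , o , q∈e) with tension p (proj₂ (proj₁ (proj₂ o)))
    ... | tense s o′ eq low others earliest =
      inj₁ (s , o′ , depth-first ys (earliest e o) q∈e ,
            subst (_≤ 3) (sym eq) (s≤s (s≤s z≤n)) , low)
    ... | calm three with low⊎high (w ρ p)
    ... | inj₁ low = inj₁ (e , o , q∈e , subst (_≤ 3) (sym (three e o)) ≤-refl , low)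
    ... | inj₂ high = inj₂ (e , o , q∈e , three e o , high)

    module _ {ρ′ : Fin m → ℕ} (mv : Moved (λ e → ¬ Two C e) ρ ρ′) where

      unmoved : ∀ {e} → (q ∈ H e → ¬ ¬ Two C e) → ρ′ e ≡ ρ e
      unmoved {e} f with edges mv e
      ... | inj₁ eq = eq
      ... | inj₂ ((_ , q∈ , ¬2) , _) = contradiction ¬2 (f q∈)

      w-cold : ∀ {x} → x ∈ C → ¬ Hot x → w ρ′ x ≡ w ρ x
      w-cold {x} x∈C cold = w-cong x same
        where
        same : ∀ e → x ∈ H e → ρ′ e ≡ ρ e
        same e x∈e with edges mv e
        ... | inj₁ eq = eq
        ... | inj₂ ((e∈A , q∈e , ¬2) , _) =
          contradiction (e , (e∈A , ¬two⇒only ¬2 x∈e x∈C) , q∈e) cold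

      -- By `closed` every free edge at z has two vertices in Z, hence in C, and so is not moved.
      w-final : ∀ {z} → z ∈ Z → w ρ′ z ≡ w ρ z
      w-final {z} z∈Z = w-cong z same
        where
        same : ∀ e → z ∈ H e → ρ′ e ≡ ρ e
        same e z∈e with edges mv e
        ... | inj₁ eq = eq
        ... | inj₂ ((e∈A , _ , ¬2) , _) = contradiction (two-mono Z⊆C (closed e e∈A z z∈Z z∈e)) ¬2

      settled-moved : ∀ {D e} → C ⊆ D → Settled Z C ρ e → Settled Z D ρ′ e
      settled-moved C⊆D (u , v , (ue , uC) , (ve , vC) , inj₁ ne) =
        u , v , (ue , C⊆D uC) , (ve , C⊆D vC) ,
        inj₁ λ eq → ne (trans (sym (classes mv u uC)) (trans eq (classes mv v vC)))
      settled-moved C⊆D (u , v , (ue , uC) , (ve , vC) , inj₂ (uZ , vZ , ne)) =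
        u , v , (ue , C⊆D uC) , (ve , C⊆D vC) ,
        inj₂ (uZ , vZ , λ eq → ne (trans (sym (w-final uZ)) (trans eq (w-final vZ))))

      unchanged-moved : ∀ e → e ∉ A → ρ′ e ≡ ρ₀ e
      unchanged-moved e e∉ with edges mv e
      ... | inj₁ eq = trans eq (unchanged e e∉)
      ... | inj₂ ((e∈ , _) , _) = contradiction e∈ e∉

      range-moved : ∀ e → e ∈ A → 1 ≤ ρ′ e × ρ′ e ≤ R
      range-moved e e∈ with edges mv e
      ... | inj₁ eq rewrite eq = range e e∈
      ... | inj₂ (_ , lo , hi) = lo , ≤-trans hi 5≤R

      -- An edge acquiring its second processed vertex at q meets C in one hot vertex, whose class
      -- differs from that of q. Edges still open at an old vertex miss q and keep their values.
      extend-moved : ∀ {D} → C ⊆ D → q ∈ D → (∀ y → y ∈ D → y ≡ q ⊎ y ∈ C) →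
                     (∀ p → Hot p → class (w ρ′ p) ≢ class (w ρ′ q)) →
                     Tension D ys ρ′ q → State D ys
      extend-moved {D} C⊆D q∈D D⊆ different tension-q = record
        { ρ = ρ′ ; Z = Z ; Z⊆C = C⊆D ∘ Z⊆C ; closed = closed
        ; untouched = λ e e∈ av → trans (unmoved (λ q∈e _ → av q q∈D q∈e))
                                        (untouched e e∈ (λ y y∈ → av y (C⊆D y∈)))
        ; settled = settled′ ; tension = tension′
        ; unchanged = unchanged-moved ; range = range-moved }
        where
        shrink : ∀ {e p} → p ∈ C → Opened D e p → Opened C e p
        shrink p∈C (e∈A , (p∈e , _) , same) = e∈A , (p∈e , p∈C) , λ y y∈ → same y (C⊆D y∈)

        settled′ : ∀ e → e ∈ A → Two D e → Settled Z D ρ′ e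
        settled′ e e∈A (u , v , ne , (ue , uD) , (ve , vD)) with trace C e | D⊆ u uD | D⊆ v vD
        ... | two t | _ | _ = settled-moved C⊆D (settled e e∈A t)
        ... | _ | inj₁ refl | inj₁ refl = contradiction refl ne
        ... | avoids av | inj₂ uC | _ = contradiction ue (av u uC)
        ... | avoids av | _ | inj₂ vC = contradiction ve (av v vC)
        ... | only p o | inj₂ uC | inj₂ vC =
          contradiction (trans (proj₂ o u uC ue) (sym (proj₂ o v vC ve))) ne
        ... | only p o | inj₁ refl | inj₂ vC with refl ← proj₂ o v vC ve =
          v , u , (ve , vD) , (ue , uD) , inj₁ (different v (e , (e∈A , o) , ue))
        ... | only p o | inj₂ uC | inj₁ refl with refl ← proj₂ o u uC ue =
          u , v , (ue , uD) , (ve , vD) , inj₁ (different u (e , (e∈A , o) , ve))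

        tension′ : ∀ p → p ∈ D → Tension D ys ρ′ p
        tension′ p p∈D with p ≟ᶠ q | D⊆ p p∈D
        ... | yes refl | _ = tension-q
        ... | no p≢q | inj₁ p≡q = contradiction p≡q p≢q
        ... | no p≢q | inj₂ p∈C = old (tension p p∈C)
          where
          q∉ : ∀ {e} → Opened D e p → q ∉ H e
          q∉ (_ , _ , same) q∈ = p≢q (sym (same q q∈D q∈))
          kept : ∀ {e} → Opened D e p → ρ′ e ≡ ρ e
          kept o = unmoved λ q∈ _ → q∉ o q∈
          old : Tension C (q ∷ ys) ρ p → Tension D ys ρ′ p
          old (calm three) = calm λ e o → trans (kept o) (three e (shrink p∈C o))
          old (tense s (s∈A , o) eq low others earliest) = branch (q ∈? H s)
            where
            branch : Dec (q ∈ H s) → Tension D ys ρ′ p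
            -- The edge of value 2 is no longer open, and only edges of value 3 are left open at p.
            branch (yes q∈s) = calm λ e o′ →
              trans (kept o′) (others e (shrink p∈C o′) λ { refl → q∉ o′ q∈s })
            branch (no q∉s) = tense s o⁺ (trans (kept o⁺) eq)
              (subst Low (sym (w-cold p∈C cold)) low)
              (λ e o′ e≢s → trans (kept o′) (others e (shrink p∈C o′) e≢s))
              (λ e o′ → depth-rest ys (earliest e (shrink p∈C o′)) q∉s (q∉ o′))
              where
              same : ∀ y → y ≡ q ⊎ y ∈ C → y ∈ H s → y ≡ p
              same y (inj₁ refl) y∈s = contradiction y∈s q∉s
              same y (inj₂ y∈C) y∈s = proj₂ o y y∈C y∈s
              o⁺ : Opened D s p
              o⁺ = s∈A , (proj₁ (proj₁ o) , p∈D) , λ y y∈D → same y (D⊆ y y∈D)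
              -- If an open edge at p contained q, so would s, being earliest. Hence p kept its
              -- weight and is still low.
              cold : ¬ Hot p
              cold (e , o′ , q∈e) = q∉s (depth-first ys (earliest e o′) q∈e)

    lowered : ∃[ ρ′ ] (Toggled ρ ρ′ × ∀ p → Hot p → Ready ρ′ p)
    lowered with lower ρ hots (λ p p∈ → able (∈-hots⁻ p∈))
    ... | ρ′ , mv , ready , _ = ρ′ , mv , λ p h → ready p (∈-hots⁺ h)

    -- Raising j of the d hot vertices gives q the weight a + 2j, from which
    -- the class ⌊a/2⌋ + j can be reached by lowering at most one untouched
    -- edge; these are d + 1 classes, and at most d of them are forbidden.
    extend : ∀ {D} → C ⊆ D → q ∈ D → (∀ y → y ∈ D → y ≡ q ⊎ y ∈ C) → q ∉ C →
             ∃[ e ] (e ∈ A × q ∈ H e × Avoids C e) → State D ys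
    extend {D} C⊆D q∈D D⊆ q∉C forward with lowered
    ... | ρ₁ , mv₁ , ready
      with pigeonhole (λ p j → class (w ρ₁ p) ≡ j + ⌊ w ρ₁ q /2⌋)
             (λ p j → class (w ρ₁ p) ≟ j + ⌊ w ρ₁ q /2⌋)
             (λ p i j eq eq′ → +-cancelʳ-≡ ⌊ w ρ₁ q /2⌋ i j (trans (sym eq) eq′))
             hots (length hots) ≤-refl
    ... | j , j≤ , free
      with raise ρ₁ (take j hots) (take⁺ j unique-hots)
             (λ p p∈ → ready p (∈-hots⁻ (∈-take j p∈)))
      where
      ∈-take : ∀ {x : Fin n} j {xs} → x ∈ˡ take j xs → x ∈ˡ xs
      ∈-take (suc j) {_ ∷ _} (here eq) = here eq
      ∈-take (suc j) {_ ∷ _} (there x∈) = there (∈-take j x∈)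
    ... | ρ₂ , mv₂ , wq , _ = finish (class-half (w ρ₂ q))
      where
      toggled : Toggled ρ ρ₂
      toggled = moved-trans mv₁ mv₂

      half : ⌊ w ρ₂ q /2⌋ ≡ j + ⌊ w ρ₁ q /2⌋
      half = begin
        ⌊ w ρ₂ q /2⌋                                ≡⟨ cong ⌊_/2⌋ wq ⟩
        ⌊ up (length (take j hots)) (w ρ₁ q) /2⌋    ≡⟨ half-up (length (take j hots)) (w ρ₁ q) ⟩
        length (take j hots) + ⌊ w ρ₁ q /2⌋         ≡⟨ cong (_+ ⌊ w ρ₁ q /2⌋) length-raised ⟩
        j + ⌊ w ρ₁ q /2⌋                            ∎
        where
        open ≡-Reasoning
        length-raised : length (take j hots) ≡ j
        length-raised = trans (length-take j hots) (m≤n⇒m⊓n≡m j≤)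

      different : ∀ p → Hot p → class (w ρ₂ p) ≢ ⌊ w ρ₂ q /2⌋
      different p h eq =
        free p (∈-hots⁺ h) (trans (sym (classes mv₂ p (hot∈ h))) (trans eq half))

      avoids-old : ∀ {e} → Opened D e q → Avoids C e
      avoids-old (_ , _ , same) y y∈C y∈e with same y (C⊆D y∈C) y∈e
      ... | refl = q∉C y∈C

      three : ∀ {e} → e ∈ A → Avoids C e → ρ₂ e ≡ 3
      three {e} e∈A av with edges toggled e
      ... | inj₁ eq = trans eq (untouched e e∈A av)
      ... | inj₂ ((_ , _ , p , (p∈e , p∈C) , _) , _) = contradiction p∈e (av p p∈C)

      finish : class (w ρ₂ q) ≡ ⌊ w ρ₂ q /2⌋ ⊎
               ∃[ k ] (w ρ₂ q ≡ suc k × class k ≡ ⌊ w ρ₂ q /2⌋ × Low k) → State D ys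
      finish (inj₁ eq) = extend-moved (toggled⇒moved toggled) C⊆D q∈D D⊆
        (λ p h eq′ → different p h (trans eq′ eq))
        (calm λ e o → three (proj₁ o) (avoids-old o))
      -- Here q must lose one: an edge with q as its first vertex drops from 3 to 2. The edge whose
      -- second vertex comes earliest is taken, as `tense` demands.
      finish (inj₂ (k , wk , ck , low))
        with argmin (λ e → e ∈? A ×-dec q ∈? H e ×-dec avoids? C e) (λ e → depth e ys) forward
      ... | s , (s∈A , q∈s , av) , earliest =
        extend-moved (moved-trans (toggled⇒moved toggled) shift) C⊆D q∈D D⊆ different₃ tension₃
        where
        ρ₃ : Fin m → ℕ
        ρ₃ = ρ₂ [ s ≔ 2 ]
        old : ∀ {p} → p ∈ C → w ρ₃ p ≡ w ρ₂ p
        old p∈C = w-update-∉ ρ₂ 2 (av _ p∈C)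
        w₃ : w ρ₃ q ≡ k
        w₃ = suc-injective (trans (sym (w-lower 1 2 (three s∈A av) q∈s)) wk)
        shift : Moved (λ e → ¬ Two C e) ρ₂ ρ₃
        shift = moved edges₃ λ p p∈C → cong class (old p∈C)
          where
          edges₃ : ∀ e → ρ₃ e ≡ ρ₂ e ⊎ ((e ∈ A × q ∈ H e × ¬ Two C e) × (1 ≤ ρ₃ e × ρ₃ e ≤ 5))
          edges₃ e with e ≟ᶠ s
          ... | no e≢s = inj₁ (≔-other ρ₂ 2 e≢s)
          ... | yes refl rewrite ≔-same ρ₂ s 2 =
            inj₂ ((s∈A , q∈s , avoids-¬two av) , s≤s z≤n , s≤s (s≤s z≤n))
        different₃ : ∀ p → Hot p → class (w ρ₃ p) ≢ class (w ρ₃ q)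
        different₃ p h eq = different p h (begin
          class (w ρ₂ p)  ≡⟨ cong class (old (hot∈ h)) ⟨
          class (w ρ₃ p)  ≡⟨ eq ⟩
          class (w ρ₃ q)  ≡⟨ cong class w₃ ⟩
          class k         ≡⟨ ck ⟩
          ⌊ w ρ₂ q /2⌋    ∎)
          where open ≡-Reasoning
        only-q : Only D s q
        only-q = (q∈s , q∈D) , λ y y∈D → same y (D⊆ y y∈D)
          where
          same : ∀ y → y ≡ q ⊎ y ∈ C → y ∈ H s → y ≡ q
          same y (inj₁ y≡q) _ = y≡q
          same y (inj₂ y∈C) y∈s = contradiction y∈s (av y y∈C)
        tension₃ : Tension D ys ρ₃ q
        tension₃ = tense s (s∈A , only-q) (≔-same ρ₂ s 2) (subst Low (sym w₃) low)
          (λ e o e≢s → trans (≔-other ρ₂ 2 e≢s) (three (proj₁ o) (avoids-old o)))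
          (λ e o → earliest e (proj₁ o , proj₁ (proj₁ (proj₂ o)) , avoids-old o))

    final : ∀ {ρ′} → Moved (λ e → ¬ Two C e) ρ ρ′ →
            (∀ p → Hot p → w ρ′ p ≢ w ρ′ q) → ∀ e → e ∈ A →
            ∃[ u ] ∃[ v ] (u ≢ v × (u ∈ H e × (u ≡ q ⊎ u ∈ C)) × (v ∈ H e × (v ≡ q ⊎ v ∈ C))) →
            ∃[ u ] ∃[ v ] ((u ∈ H e × (u ≡ q ⊎ u ∈ C)) × (v ∈ H e × (v ≡ q ⊎ v ∈ C)) ×
                           w ρ′ u ≢ w ρ′ v)
    final {ρ′} mv different e e∈A (u , v , ne , (ue , uD) , (ve , vD)) with trace C e | uD | vD
    ... | _ | inj₁ refl | inj₁ refl = contradiction refl ne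
    ... | avoids av | inj₂ uC | _ = contradiction ue (av u uC)
    ... | avoids av | _ | inj₂ vC = contradiction ve (av v vC)
    ... | only p o | inj₂ uC | inj₂ vC =
      contradiction (trans (proj₂ o u uC ue) (sym (proj₂ o v vC ve))) ne
    ... | only p o | inj₁ refl | inj₂ vC with refl ← proj₂ o v vC ve =
      v , u , (ve , vD) , (ue , uD) , different v (e , (e∈A , o) , ue)
    ... | only p o | inj₂ uC | inj₁ refl with refl ← proj₂ o u uC ue =
      u , v , (ue , uD) , (ve , vD) , different u (e , (e∈A , o) , ve)
    ... | two t | _ | _ with settled-moved mv (λ x → x) (settled e e∈A t)
    ... | a , b , (ae , aC) , (be , bC) , inj₁ cl =
      a , b , (ae , inj₂ aC) , (be , inj₂ bC) , λ eq → cl (cong class eq)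
    ... | a , b , (ae , aC) , (be , bC) , inj₂ (_ , _ , d) =
      a , b , (ae , inj₂ aC) , (be , inj₂ bC) , d

    -- With all hot vertices low, it suffices to raise none, one or two of them.
    close : ∀ {p₁ p₂} → Hot p₁ → Hot p₂ → p₁ ≢ p₂ →
            ∃[ ρ′ ] (Moved (λ e → ¬ Two C e) ρ ρ′ × ∀ p → Hot p → w ρ′ p ≢ w ρ′ q)
    close {p₁} {p₂} h₁ h₂ p₁≢p₂ with lowered
    ... | ρ₁ , mv₁ , ready with any? (λ p → hot? p ×-dec w ρ₁ p ≟ w ρ₁ q)
    ... | no none = ρ₁ , toggled⇒moved mv₁ , λ p h eq → none (p , h , eq)
    ... | yes (p₀ , h₀ , eq₀) with any? (λ p → hot? p ×-dec ¬? (w ρ₁ p ≟ w ρ₁ q))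
    -- With p raised alone, p and q both gain 2 and remain different; q becomes high, while the
    -- other hot vertices stay low.
    ... | yes (p , h , ne) with raise ρ₁ (p ∷ []) ([] ∷ []) (λ { x (here refl) → ready x h })
    ... | ρ₂ , mv₂ , wq , ins , outs = ρ₂ , toggled⇒moved (moved-trans mv₁ mv₂) , different
      where
      low-q : Low (w ρ₁ q)
      low-q = subst Low eq₀ (proj₂ (proj₂ (proj₂ (proj₂ (ready p₀ h₀)))))
      different : ∀ x → Hot x → w ρ₂ x ≢ w ρ₂ q
      different x hx eq with x ≟ᶠ p
      ... | yes refl = ne (suc-injective (suc-injective
                         (trans (sym (ins x (hot∈ hx) (here refl))) (trans eq wq))))
      ... | no x≢p = low∧high (w ρ₁ x) (proj₂ (proj₂ (proj₂ (proj₂ (ready x hx)))))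
          (subst High (sym (trans (sym (outs x (hot∈ hx) λ { (here x≡p) → x≢p x≡p }))
                                  (trans eq wq)))
            (proj₂ (raise-low (w ρ₁ q) low-q)))
    -- All hot vertices weigh as much as q. Raising two of them adds 4 to q, but only 0 or 2 to each
    -- hot vertex.
    close {p₁} {p₂} h₁ h₂ p₁≢p₂ | ρ₁ , mv₁ , ready | yes _ | no all
      with raise ρ₁ (p₁ ∷ p₂ ∷ []) ((p₁≢p₂ ∷ []) ∷ [] ∷ [])
             (λ { x (here refl) → ready x h₁ ; x (there (here refl)) → ready x h₂ })
    ... | ρ₂ , mv₂ , wq , ins , outs = ρ₂ , toggled⇒moved (moved-trans mv₁ mv₂) , different
      where
      equal : ∀ x → Hot x → w ρ₁ x ≡ w ρ₁ q
      equal x hx = decidable-stable (w ρ₁ x ≟ w ρ₁ q) λ ne → all (x , hx , ne)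
      open ≡-Reasoning
      raised : ∀ x → Hot x → x ∈ˡ p₁ ∷ p₂ ∷ [] → w ρ₂ x ≢ w ρ₂ q
      raised x hx x∈ eq = m≢1+n+m (2 + w ρ₁ q) {1} (begin
        2 + w ρ₁ q    ≡⟨ cong (2 +_) (equal x hx) ⟨
        2 + w ρ₁ x    ≡⟨ ins x (hot∈ hx) x∈ ⟨
        w ρ₂ x        ≡⟨ eq ⟩
        w ρ₂ q        ≡⟨ wq ⟩
        4 + w ρ₁ q    ∎)
      different : ∀ x → Hot x → w ρ₂ x ≢ w ρ₂ q
      different x hx eq with x ≟ᶠ p₁ | x ≟ᶠ p₂
      ... | yes refl | _ = raised x hx (here refl) eq
      ... | no _ | yes refl = raised x hx (there (here refl)) eq
      ... | no ne₁ | no ne₂ = m≢1+n+m (w ρ₁ q) {3} (begin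
        w ρ₁ q        ≡⟨ equal x hx ⟨
        w ρ₁ x        ≡⟨ outs x (hot∈ hx) (λ { (here e) → ne₁ e ; (there (here e)) → ne₂ e }) ⟨
        w ρ₂ x        ≡⟨ eq ⟩
        w ρ₂ q        ≡⟨ wq ⟩
        4 + w ρ₁ q    ∎)

  meeting? : ∀ Z e → Dec (e ∈ A × ¬ Avoids Z e)
  meeting? Z e = e ∈? A ×-dec ¬? (avoids? Z e)

  Meeting : Subset n → Subset m
  Meeting Z = ⟪ meeting? Z ⟫

  module _ {M : Subset n} {v : Fin n} (v∈M : v ∈ M) (twos : ∀ e → e ∈ A → Two M e)
           (solve : ∀ Z → Z ⊆ M - v → (∀ e → e ∈ A → ¬ Avoids Z e → Two Z e) →
                    Solution R ρ₀ Z (Meeting Z)) where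

    -- Where peeling stops, edges meeting Z take their values from the inductive solution; the
    -- others do not affect weights in Z and start at 3. No edge is open, so all vertices are calm.
    start : ∀ Z ys → Z ⊆ M - v → (∀ e → e ∈ A → ¬ Avoids Z e → Two Z e) → State Z ys
    start Z ys Z⊆ stuck = record
      { ρ = ρ ; Z = Z ; Z⊆C = λ z → z
      ; closed = λ e e∈A z z∈Z z∈e → stuck e e∈A λ av → av z z∈Z z∈e
      ; untouched = λ e e∈A av → fresh e (e∈A , av)
      ; settled = settled ; tension = λ p p∈ → calm λ e (e∈A , o) →
          contradiction (stuck e e∈A λ av → av p p∈ (proj₁ (proj₁ o))) (only-¬two o)
      ; unchanged = λ e e∉A → trans (old e (e∉A ∘ proj₁))
                    (S.unchanged e (e∉A ∘ proj₁ ∘ ∈⟪⟫⁻ (meeting? Z)))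
      ; range = range }
      where
      module S = Solution (solve Z Z⊆ stuck)
      fresh? : ∀ e → Dec (e ∈ A × Avoids Z e)
      fresh? e = e ∈? A ×-dec avoids? Z e
      ρ : Fin m → ℕ
      ρ e = if does (fresh? e) then 3 else S.ρ e
      fresh : ∀ e → e ∈ A × Avoids Z e → ρ e ≡ 3
      fresh e f rewrite dec-true (fresh? e) f = refl
      old : ∀ e → ¬ (e ∈ A × Avoids Z e) → ρ e ≡ S.ρ e
      old e ¬f rewrite dec-false (fresh? e) ¬f = refl
      w-old : ∀ {z} → z ∈ Z → w ρ z ≡ w S.ρ z
      w-old {z} z∈Z = w-cong z λ e z∈e → old e λ (_ , av) → av z z∈Z z∈e
      settled : ∀ e → e ∈ A → Two Z e → Settled Z Z ρ e
      settled e e∈A t with S.bichromatic e (∈⟪⟫⁺ (meeting? Z) (e∈A , λ av → avoids-¬two av t))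
      ... | a , b , (ae , aZ) , (be , bZ) , ne = a , b , (ae , aZ) , (be , bZ) ,
        inj₂ (aZ , bZ , λ eq → ne (trans (sym (w-old aZ)) (trans eq (w-old bZ))))
      range : ∀ e → e ∈ A → 1 ≤ ρ e × ρ e ≤ R
      range e e∈A with avoids? Z e
      ... | yes av rewrite fresh e (e∈A , av) = s≤s z≤n , ≤-trans (s≤s (s≤s (s≤s z≤n))) 5≤R
      ... | no ¬av rewrite old e (¬av ∘ proj₂) = S.range e (∈⟪⟫⁺ (meeting? Z) (e∈A , ¬av))

    -- An edge in which x is alone has x as its first vertex in the processing order, and so is the
    -- edge that `extend` requires. Accordingly x comes right after `C - x`.
    process : ∀ k C ys → ∣ C ∣ < k → C ⊆ M - v → State C ys
    process (suc k) C ys (s≤s le) C⊆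
      with any? (λ x → any? λ e → e ∈? A ×-dec only? C e x)
    ... | yes (x , e , e∈A , (x∈e , x∈C) , same) =
      Step.extend (process k (C - x) (x ∷ ys) (<-≤-trans (x∈p⇒∣p-x∣<∣p∣ x∈C) le)
                     (λ y∈ → C⊆ (proj₁ (∈-⁻ C y∈))))
        (λ y∈ → proj₁ (∈-⁻ C y∈)) x∈C split (x∉p-x x C)
        (e , e∈A , x∈e , λ y y∈ y∈e → proj₂ (∈-⁻ C y∈) (same y (proj₁ (∈-⁻ C y∈)) y∈e))
      where
      split : ∀ y → y ∈ C → y ≡ x ⊎ y ∈ C - x
      split y y∈ with y ≟ᶠ x
      ... | yes eq = inj₁ eq
      ... | no ne = inj₂ (x∈p∧x≢y⇒x∈p-y y∈ ne)
    ... | no none = start C ys C⊆ stuck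
      where
      stuck : ∀ e → e ∈ A → ¬ Avoids C e → Two C e
      stuck e e∈A ¬av with trace C e
      ... | avoids av = contradiction av ¬av
      ... | only p o = contradiction (p , e , e∈A , o) none
      ... | two t = t

    -- No edge of A avoids `M - v`, so `extend` cannot handle the last vertex v. The two traces of
    -- size two at v make a and b hot, as `close` requires.
    block : ∀ {e₁ e₂ a b} → e₁ ∈ A → e₂ ∈ A → Only (M - v) e₁ a → Only (M - v) e₂ b →
            v ∈ H e₁ → v ∈ H e₂ → a ≢ b → Solution R ρ₀ M A
    block {e₁} {e₂} e₁∈ e₂∈ o₁ o₂ v∈e₁ v∈e₂ a≢b =
      conclude (close (e₁ , (e₁∈ , o₁) , v∈e₁) (e₂ , (e₂∈ , o₂) , v∈e₂) a≢b)
      where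
      open Step (process (suc ∣ M - v ∣) (M - v) (v ∷ []) ≤-refl (λ x → x))
      open Toggling H A (M - v) v using (Hot; Moved)
      split : ∀ {y} → y ∈ M → y ≡ v ⊎ y ∈ M - v
      split {y} y∈ with y ≟ᶠ v
      ... | yes eq = inj₁ eq
      ... | no ne = inj₂ (x∈p∧x≢y⇒x∈p-y y∈ ne)
      merge : ∀ {y} → y ≡ v ⊎ y ∈ M - v → y ∈ M
      merge (inj₁ refl) = v∈M
      merge (inj₂ y∈) = proj₁ (∈-⁻ M y∈)
      conclude : ∃[ ρ′ ] (Moved (λ e → ¬ Two (M - v) e) _ ρ′ × ∀ p → Hot p → w ρ′ p ≢ w ρ′ v) →
                 Solution R ρ₀ M A
      conclude (ρ′ , mv , different) = record
        { ρ = ρ′ ; unchanged = unchanged-moved mv ; range = range-moved mv ; bichromatic = bi }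
        where
        bi : ∀ e → e ∈ A → Bichromatic M ρ′ e
        bi e e∈A with twos e e∈A
        ... | x , y , ne , (xe , xM) , (ye , yM)
          with final mv different e e∈A (x , y , ne , (xe , split xM) , (ye , split yM))
        ... | x′ , y′ , (xe′ , x∈) , (ye′ , y∈) , d =
          x′ , y′ , (xe′ , merge x∈) , (ye′ , merge y∈) , d

-- Traces of size two that form a perfect matching.

module Matching
  {n m r : ℕ} (H : Hypergraph n m) (size : ∀ e → ∣ H e ∣ ≤ r)
  (R : ℕ) (5≤R : 5 ≤ R) (r+1≤R : r + 1 ≤ R)
  (M : Subset n) (A : Subset m) (ρ₀ : Fin m → ℕ)
  (twos : ∀ e → e ∈ A → Traces.Two H M e)
  (distinct : ∀ u v → u ∈ M → v ∈ M → u ≢ v →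
    ∃[ e ] (e ∈ A × Weights.Separates H e u v) ⊎ Weights.w H ρ₀ u ≢ Weights.w H ρ₀ v)
  (μ : Fin n → Fin n) (μ-involutive : ∀ x → μ (μ x) ≡ x)
  (μ∈ : ∀ {x} → x ∈ M → μ x ∈ M) (μ≢ : ∀ {x} → x ∈ M → x ≢ μ x)
  (link : Fin n → Fin m) (link∈A : ∀ {x} → x ∈ M → link x ∈ A)
  (x∈link : ∀ {x} → x ∈ M → x ∈ H (link x)) (μ∈link : ∀ {x} → x ∈ M → μ x ∈ H (link x))
  (link-only : ∀ {x y} → x ∈ M → y ∈ M → y ∈ H (link x) → y ≡ x ⊎ y ≡ μ x)
  (pair-mate : ∀ {e x y} → e ∈ A → x ∈ H e → x ∈ M → y ∈ H e → y ∈ M → x ≢ y →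
    (∀ z → z ∈ M → z ∈ H e → z ≡ x ⊎ z ≡ y) → y ≡ μ x)
  where

  open Weights H
  open Traces H
  open Greedy H size μ μ-involutive
  open Triples using (shift-apart)

  Independent : Fin m → Set
  Independent e = ∀ u → u ∈ M → u ∈ H e → μ u ∉ H e

  independent? : ∀ e → Dec (Independent e)
  independent? e = all? λ u → (u ∈? M) →-dec (u ∈? H e) →-dec ¬? (μ u ∈? H e)

  dependent : ∀ {e} → ¬ Independent e → ∃[ u ] (u ∈ M × u ∈ H e × μ u ∈ H e)
  dependent {e} ¬ind with any? (λ u → u ∈? M ×-dec u ∈? H e ×-dec μ u ∈? H e)
  ... | yes d = d
  ... | no none = contradiction (λ u u∈M u∈e μu∈e → none (u , u∈M , u∈e , μu∈e)) ¬ind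

  no-independent : (∀ e → e ∈ A → ¬ Independent e) → Solution R ρ₀ M A
  no-independent none with greedy M (filter (_∈? A) (allFin m)) ρ₀ separated
    where
    separated : ∀ u → u ∈ M →
      ∃[ e ] (e ∈ˡ filter (_∈? A) (allFin m) × Separates e u (μ u)) ⊎ w ρ₀ u ≢ w ρ₀ (μ u)
    separated u u∈M with distinct u (μ u) u∈M (μ∈ u∈M) (μ≢ u∈M)
    ... | inj₁ (e , e∈A , s) = inj₁ (e , ∈-filter⁺ (_∈? A) (∈-allFin e) e∈A , s)
    ... | inj₂ d = inj₂ d
  ... | ρ , same , range , differ = record
    { ρ = ρ
    ; unchanged = λ e e∉A → same e λ e∈ → e∉A (proj₂ (∈-filter⁻ (_∈? A) {xs = allFin m} e∈))
    ; range = λ e e∈A → let lo , hi = range e (∈-filter⁺ (_∈? A) (∈-allFin e) e∈A)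
                        in lo , ≤-trans hi r+1≤R
    ; bichromatic = λ e e∈A → let u , u∈M , u∈e , μu∈e = dependent (none e e∈A)
        in u , μ u , (u∈e , u∈M) , (μu∈e , μ∈ u∈M) , differ u u∈M }

  shadow? : ∀ e v → Dec (v ∈ M × (v ∈ H e ⊎ μ v ∈ H e))
  shadow? e v = v ∈? M ×-dec (v ∈? H e ⊎-dec μ v ∈? H e)

  -- The union of the matched pairs met by e, of size twice their number.
  shadow : Fin m → Subset n
  shadow e = ⟪ shadow? e ⟫

  Hits : Fin m → Fin n → Set
  Hits e u = u ∈ H e ⊎ μ u ∈ H e

  hits? : ∀ e u → Dec (Hits e u)
  hits? e u = u ∈? H e ⊎-dec μ u ∈? H e

  module Removal (h : Fin m) (h∈A : h ∈ A) (ind : Independent h)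
                 (minimal : ∀ e → e ∈ A × Independent e → ∣ shadow h ∣ ≤ ∣ shadow e ∣)
                 (solve : ∀ M′ A′ ρ → ∣ M′ ∣ < ∣ M ∣ → (∀ e → e ∈ A′ → Two M′ e) →
                   (∀ u v → u ∈ M′ → v ∈ M′ → u ≢ v →
                     ∃[ e ] (e ∈ A′ × Separates e u v) ⊎ w ρ u ≢ w ρ v) →
                   Solution R ρ M′ A′)
                 where

    outer? : ∀ v → Dec (v ∈ M × v ∉ shadow h)
    outer? v = v ∈? M ×-dec ¬? (v ∈? shadow h)

    M′ : Subset n
    M′ = ⟪ outer? ⟫

    M′⊆M : M′ ⊆ M
    M′⊆M x∈ = proj₁ (∈⟪⟫⁻ outer? x∈)

    shadow⁺ : ∀ {v} → v ∈ M → Hits h v → v ∈ shadow h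
    shadow⁺ v∈M hit = ∈⟪⟫⁺ (shadow? h) (v∈M , hit)

    hits-mate : ∀ {e v} → Hits e v → Hits e (μ v)
    hits-mate (inj₁ v∈) = inj₂ (subst (_∈ _) (sym (μ-involutive _)) v∈)
    hits-mate (inj₂ μv∈) = inj₁ μv∈

    mate-hits : ∀ {e v} → Hits e (μ v) → Hits e v
    mate-hits {e} {v} hit = subst (Hits e) (μ-involutive v) (hits-mate hit)

    ∈M′⁺ : ∀ {v} → v ∈ M → ¬ Hits h v → v ∈ M′
    ∈M′⁺ v∈M ¬hit = ∈⟪⟫⁺ outer? (v∈M , ¬hit ∘ proj₂ ∘ ∈⟪⟫⁻ (shadow? h))

    ∈M′⁻ : ∀ {v} → v ∈ M′ → ¬ Hits h v
    ∈M′⁻ v∈ hit = proj₂ (∈⟪⟫⁻ outer? v∈) (shadow⁺ (M′⊆M v∈) hit)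

    μ∈M′ : ∀ {v} → v ∈ M′ → μ v ∈ M′
    μ∈M′ v∈ = ∈M′⁺ (μ∈ (M′⊆M v∈)) (∈M′⁻ v∈ ∘ mate-hits)

    h-avoids : ∀ {v} → v ∈ M′ → v ∉ H h
    h-avoids v∈ v∈h = ∈M′⁻ v∈ (inj₁ v∈h)

    -- Otherwise the shadow of e loses three vertices of the shadow of h and
    -- gains at most two, against the choice of h.
    hits-one-of : ∀ {e a b} → e ∈ A → Independent e → ¬ Two M′ e →
                  a ∈ M → a ∈ H h → b ∈ M → b ∈ H h → a ≢ b → ¬ Hits e a → Hits e b
    hits-one-of {e} {a} {b} e∈A ind-e ¬two a∈M a∈h b∈M b∈h a≢b ¬a =
      decidable-stable (hits? e b) λ ¬b → <⇒≱ (smaller ¬b) (minimal e (e∈A , ind-e))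
      where
      single : ∃[ x ] (∀ y → y ∈ M′ → y ∈ H e → y ≡ x)
      single with trace M′ e
      -- The vertex a is a placeholder: no such y exists.
      ... | avoids av = a , λ y y∈ y∈e → contradiction y∈e (av y y∈)
      ... | only x o = x , proj₂ o
      ... | two t = contradiction t ¬two
      x : Fin n
      x = proj₁ single
      rest : ¬ Hits e b → shadow e - x - μ x ⊆ shadow h - a - μ a - b
      rest ¬b {y} y∈ with ∈-⁻ (shadow e - x) y∈
      ... | y∈₁ , y≢μx with ∈-⁻ (shadow e) y∈₁
      ... | y∈₂ , y≢x with ∈⟪⟫⁻ (shadow? e) y∈₂
      ... | y∈M , hit = x∈p∧x≢y⇒x∈p-y (x∈p∧x≢y⇒x∈p-y (x∈p∧x≢y⇒x∈p-y
              (shadow⁺ y∈M (decidable-stable (hits? h y) (λ ¬h → settled ¬h hit)))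
              λ { refl → ¬a hit }) λ { refl → ¬a (mate-hits hit) }) λ { refl → ¬b hit }
        where
        settled : ¬ Hits h y → ¬ Hits e y
        settled ¬h (inj₁ y∈e) = y≢x (proj₂ single y (∈M′⁺ y∈M ¬h) y∈e)
        settled ¬h (inj₂ μy∈e) = y≢μx (trans (sym (μ-involutive y))
          (cong μ (proj₂ single (μ y) (∈M′⁺ (μ∈ y∈M) (¬h ∘ mate-hits)) μy∈e)))
      smaller : ¬ Hits e b → ∣ shadow e ∣ < ∣ shadow h ∣
      smaller ¬b = ≤-trans (s≤s (≤-trans (∣p∣≤1+∣p-x∣ (shadow e) x) (s≤s (≤-trans
          (∣p∣≤1+∣p-x∣ (shadow e - x) (μ x)) (s≤s (p⊆q⇒∣p∣≤∣q∣ (rest ¬b)))))))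
        (<-≤-trans′ (x∈p⇒∣p-x∣<∣p∣ b∈₂) (x∈p⇒∣p-x∣<∣p∣ μa∈₁) (x∈p⇒∣p-x∣<∣p∣ a∈₀))
        where
        a∈₀ : a ∈ shadow h
        a∈₀ = shadow⁺ a∈M (inj₁ a∈h)
        μa∈₁ : μ a ∈ shadow h - a
        μa∈₁ = x∈p∧x≢y⇒x∈p-y (shadow⁺ (μ∈ a∈M) (hits-mate (inj₁ a∈h))) (μ≢ a∈M ∘ sym)
        b∈₂ : b ∈ shadow h - a - μ a
        b∈₂ = x∈p∧x≢y⇒x∈p-y (x∈p∧x≢y⇒x∈p-y (shadow⁺ b∈M (inj₁ b∈h)) (a≢b ∘ sym))
                λ { refl → ind a a∈M a∈h b∈h }
        <-≤-trans′ : ∀ {i j k l} → i < j → j < k → k < l → 3 + i ≤ l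
        <-≤-trans′ p q r = ≤-trans (s≤s (≤-trans (s≤s p) q)) r

    inner? : ∀ e → Dec (e ∈ A × Two M′ e)
    inner? e = e ∈? A ×-dec two? M′ e

    A′ : Subset m
    A′ = ⟪ inner? ⟫

    near? : ∀ e → Dec (e ∈ A × ¬ Two M′ e)
    near? e = e ∈? A ×-dec ¬? (two? M′ e)

    near : List (Fin m)
    near = filter near? (allFin m)

    near⁺ : ∀ {e} → e ∈ A → ¬ Two M′ e → e ∈ˡ near
    near⁺ e∈A ¬two = ∈-filter⁺ near? (∈-allFin _) (e∈A , ¬two)

    near⁻ : ∀ {e} → e ∈ˡ near → e ∈ A × ¬ Two M′ e
    near⁻ e∈ = proj₂ (∈-filter⁻ near? {xs = allFin m} e∈)

    twin? : ∀ v → Dec (v ∈ M′ × ¬ (∃[ e ] (e ∈ A′ × Separates e v (μ v))))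
    twin? v = v ∈? M′ ×-dec ¬? (any? λ e → e ∈? A′ ×-dec separates? e v (μ v))

    -- Mates in M′ that no edge of A′ separates would violate the invariant for M′. The edges
    -- outside A′ are fixed beforehand so that these mates already differ in weight.
    fix-near : ∃[ ρ ] ((∀ e → e ∉ˡ near → ρ e ≡ ρ₀ e) ×
                       (∀ e → e ∈ˡ near → 1 ≤ ρ e × ρ e ≤ r + 1) ×
                       (∀ u → u ∈ ⟪ twin? ⟫ → w ρ u ≢ w ρ (μ u)))
    fix-near = greedy ⟪ twin? ⟫ near ρ₀ separated
      where
      separated : ∀ u → u ∈ ⟪ twin? ⟫ →
                  ∃[ e ] (e ∈ˡ near × Separates e u (μ u)) ⊎ w ρ₀ u ≢ w ρ₀ (μ u)
      separated u u∈ with ∈⟪⟫⁻ twin? u∈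
      ... | u∈M′ , twin with distinct u (μ u) (M′⊆M u∈M′) (μ∈ (M′⊆M u∈M′)) (μ≢ (M′⊆M u∈M′))
      ... | inj₂ d = inj₂ d
      ... | inj₁ (e , e∈A , s) =
        inj₁ (e , near⁺ e∈A (λ t → twin (e , ∈⟪⟫⁺ inner? (e∈A , t) , s)) , s)

    distinct′ : ∀ ρ → (∀ u → u ∈ ⟪ twin? ⟫ → w ρ u ≢ w ρ (μ u)) →
                ∀ u v → u ∈ M′ → v ∈ M′ → u ≢ v →
                ∃[ e ] (e ∈ A′ × Separates e u v) ⊎ w ρ u ≢ w ρ v
    distinct′ ρ twins u v u∈ v∈ u≢v with v ≟ᶠ μ u
    ... | no v≢μu = inj₁ (link u ,
        ∈⟪⟫⁺ inner? (link∈A u∈M , u , μ u , μ≢ u∈M ,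
          (x∈link u∈M , u∈) , (μ∈link u∈M , μ∈M′ u∈)) ,
        inj₁ (x∈link u∈M , λ v∈link → outsider (link-only u∈M (M′⊆M v∈) v∈link)))
      where
      u∈M : u ∈ M
      u∈M = M′⊆M u∈
      outsider : ¬ (v ≡ u ⊎ v ≡ μ u)
      outsider (inj₁ v≡u) = u≢v (sym v≡u)
      outsider (inj₂ v≡μu) = v≢μu v≡μu
    ... | yes refl with any? (λ e → e ∈? A′ ×-dec separates? e u (μ u))
    ... | yes s = inj₁ s
    ... | no none = inj₂ (twins u (∈⟪⟫⁺ twin? (u∈ , none)))

    smaller : ∀ {a} → a ∈ M → a ∈ H h → ∣ M′ ∣ < ∣ M ∣
    smaller a∈M a∈h = p⊂q⇒∣p∣<∣q∣ (M′⊆M , _ , a∈M , λ a∈ → h-avoids a∈ a∈h)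

    -- As h contains no pair, it separates each pair that it meets, so its value alone suffices. It
    -- misses M′ and can wait until M′ is solved.
    fix-h : ∀ ρ₂ → ∃[ ρ ] ((∀ e → e ∉ˡ h ∷ [] → ρ e ≡ ρ₂ e) ×
                           (∀ e → e ∈ˡ h ∷ [] → 1 ≤ ρ e × ρ e ≤ r + 1) ×
                           (∀ u → u ∈ shadow h → w ρ u ≢ w ρ (μ u)))
    fix-h ρ₂ = greedy (shadow h) (h ∷ []) ρ₂ λ u u∈ →
      let u∈M , hit = ∈⟪⟫⁻ (shadow? h) u∈ in inj₁ (h , here refl , one-sided u∈M hit)
      where
      one-sided : ∀ {u} → u ∈ M → Hits h u → Separates h u (μ u)
      one-sided u∈M (inj₁ u∈h) = inj₁ (u∈h , ind _ u∈M u∈h)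
      one-sided u∈M (inj₂ μu∈h) = inj₂ (μu∈h , λ u∈h → ind _ u∈M u∈h μu∈h)

    Unit : Fin n → Fin n → Set
    Unit x y = y ≡ x ⊎ y ≡ μ x

    unit∈M : ∀ {x y} → x ∈ M → Unit x y → y ∈ M
    unit∈M x∈M (inj₁ refl) = x∈M
    unit∈M x∈M (inj₂ refl) = μ∈ x∈M

    unit∈link : ∀ {x y} → x ∈ M → Unit x y → y ∈ H (link x)
    unit∈link x∈M (inj₁ refl) = x∈link x∈M
    unit∈link x∈M (inj₂ refl) = μ∈link x∈M

    -- Distinct vertices of h belong to different pairs, since h contains no pair; so each of the
    -- three matching edges affects only one of the three pairs.
    apart : ∀ {x y z} → x ∈ M → x ∈ H h → y ∈ H h → x ≢ y → Unit x z → ¬ Unit y z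
    apart x∈M x∈h y∈h x≢y (inj₁ refl) (inj₁ refl) = x≢y refl
    apart x∈M x∈h y∈h x≢y (inj₁ refl) (inj₂ refl) =
      ind _ x∈M x∈h (subst (_∈ H h) (sym (μ-involutive _)) y∈h)
    apart x∈M x∈h y∈h x≢y (inj₂ refl) (inj₁ refl) = ind _ x∈M x∈h y∈h
    apart x∈M x∈h y∈h x≢y (inj₂ refl) (inj₂ eq) =
      x≢y (trans (sym (μ-involutive _)) (trans (cong μ eq) (μ-involutive _)))

    unit∉link : ∀ {x y z} → x ∈ M → x ∈ H h → y ∈ M → y ∈ H h → x ≢ y → Unit x z → z ∉ H (link y)
    unit∉link x∈M x∈h y∈M y∈h x≢y u z∈ =
      apart x∈M x∈h y∈h x≢y u (link-only y∈M (unit∈M x∈M u) z∈)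

    link-≢ : ∀ {x y} → x ∈ M → x ∈ H h → y ∈ M → y ∈ H h → x ≢ y → link x ≢ link y
    link-≢ x∈M x∈h y∈M y∈h x≢y eq =
      unit∉link x∈M x∈h y∈M y∈h x≢y (inj₁ refl) (subst (λ e → _ ∈ H e) eq (x∈link x∈M))

    module Repair
      (ρ₂ ρ₃ : Fin m → ℕ)
      (near-unchanged : ∀ e → e ∉ A → ρ₂ e ≡ ρ₀ e)
      (near-range : ∀ e → e ∈ A → 1 ≤ ρ₂ e × ρ₂ e ≤ R)
      (settled : ∀ e → e ∈ A → Two M′ e → Bichromatic M′ ρ₂ e)
      (h-same : ∀ e → e ≢ h → ρ₃ e ≡ ρ₂ e)
      (h-range : 1 ≤ ρ₃ h × ρ₃ h ≤ R)
      (mates : ∀ u → u ∈ shadow h → w ρ₃ u ≢ w ρ₃ (μ u))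
      (a b c : Fin n) (a∈M : a ∈ M) (b∈M : b ∈ M) (c∈M : c ∈ M)
      (a∈h : a ∈ H h) (b∈h : b ∈ H h) (c∈h : c ∈ H h)
      (a≢b : a ≢ b) (a≢c : a ≢ c) (b≢c : b ≢ c) where

      -- `set 0 0 0` is the base: each end of a chosen pair weighs its base weight plus the value of
      -- its own matching edge. The value 0 occurs only in this base.
      set : ℕ → ℕ → ℕ → Fin m → ℕ
      set i j k = ρ₃ [ link a ≔ i ] [ link b ≔ j ] [ link c ≔ k ]

      set-a : ∀ i j k → set i j k (link a) ≡ i
      set-a i j k = trans (≔-other _ k (link-≢ a∈M a∈h c∈M c∈h a≢c))
                   (trans (≔-other _ j (link-≢ a∈M a∈h b∈M b∈h a≢b)) (≔-same ρ₃ (link a) i))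

      set-b : ∀ i j k → set i j k (link b) ≡ j
      set-b i j k = trans (≔-other _ k (link-≢ b∈M b∈h c∈M c∈h b≢c)) (≔-same _ (link b) j)

      set-c : ∀ i j k → set i j k (link c) ≡ k
      set-c i j k = ≔-same _ (link c) k

      set-other : ∀ i j k {e} → e ≢ link a → e ≢ link b → e ≢ link c → set i j k e ≡ ρ₃ e
      set-other i j k ≢a ≢b ≢c = trans (≔-other _ k ≢c) (trans (≔-other _ j ≢b) (≔-other ρ₃ i ≢a))

      w-set : ∀ {x y} i j k → x ∈ M → Unit x y →
              (∀ e → y ∈ H e → e ≢ link x → set i j k e ≡ set 0 0 0 e) →
              set 0 0 0 (link x) ≡ 0 → w (set i j k) y ≡ w (set 0 0 0) y + set i j k (link x)
      w-set {x} {y} i j k x∈M u same zeroed = trans (sym (+-identityʳ _))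
        (trans (cong (w (set i j k) y +_) (sym zeroed)) (w-single (unit∈link x∈M u) same))

      w-set-a : ∀ {y} i j k → Unit a y → w (set i j k) y ≡ w (set 0 0 0) y + i
      w-set-a {y} i j k u = trans (w-set i j k a∈M u same (set-a 0 0 0)) (cong (_ +_) (set-a i j k))
        where
        same : ∀ e → y ∈ H e → e ≢ link a → set i j k e ≡ set 0 0 0 e
        same e y∈e ≢a = trans (set-other i j k ≢a ≢b ≢c) (sym (set-other 0 0 0 ≢a ≢b ≢c))
          where
          ≢b : e ≢ link b
          ≢b refl = unit∉link a∈M a∈h b∈M b∈h a≢b u y∈e
          ≢c : e ≢ link c
          ≢c refl = unit∉link a∈M a∈h c∈M c∈h a≢c u y∈e

      w-set-b : ∀ {y} i j k → Unit b y → w (set i j k) y ≡ w (set 0 0 0) y + j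
      w-set-b {y} i j k u = trans (w-set i j k b∈M u same (set-b 0 0 0)) (cong (_ +_) (set-b i j k))
        where
        same : ∀ e → y ∈ H e → e ≢ link b → set i j k e ≡ set 0 0 0 e
        same e y∈e ≢b = trans (set-other i j k ≢a ≢b ≢c) (sym (set-other 0 0 0 ≢a ≢b ≢c))
          where
          ≢a : e ≢ link a
          ≢a refl = unit∉link b∈M b∈h a∈M a∈h (a≢b ∘ sym) u y∈e
          ≢c : e ≢ link c
          ≢c refl = unit∉link b∈M b∈h c∈M c∈h b≢c u y∈e

      w-set-c : ∀ {y} i j k → Unit c y → w (set i j k) y ≡ w (set 0 0 0) y + k
      w-set-c {y} i j k u = trans (w-set i j k c∈M u same (set-c 0 0 0)) (cong (_ +_) (set-c i j k))
        where
        same : ∀ e → y ∈ H e → e ≢ link c → set i j k e ≡ set 0 0 0 e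
        same e y∈e ≢c = trans (set-other i j k ≢a ≢b ≢c) (sym (set-other 0 0 0 ≢a ≢b ≢c))
          where
          ≢a : e ≢ link a
          ≢a refl = unit∉link c∈M c∈h a∈M a∈h (a≢c ∘ sym) u y∈e
          ≢b : e ≢ link b
          ≢b refl = unit∉link c∈M c∈h b∈M b∈h (b≢c ∘ sym) u y∈e

      -- Two ends against two ends: the four comparisons allowed in `shift-apart`.
      conflicts : Fin n → Fin n → List (ℕ × ℕ)
      conflicts x y = (v x , v y) ∷ (v x , v (μ y)) ∷ (v (μ x) , v y) ∷ (v (μ x) , v (μ y)) ∷ []
        where
        v : Fin n → ℕ
        v = w (set 0 0 0)

      ∈-conflicts : ∀ {x y x′ y′} → Unit x x′ → Unit y y′ →
                    (w (set 0 0 0) x′ , w (set 0 0 0) y′) ∈ˡ conflicts x y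
      ∈-conflicts (inj₁ refl) (inj₁ refl) = here refl
      ∈-conflicts (inj₁ refl) (inj₂ refl) = there (here refl)
      ∈-conflicts (inj₂ refl) (inj₁ refl) = there (there (here refl))
      ∈-conflicts (inj₂ refl) (inj₂ refl) = there (there (there (here refl)))

      module Shifted (i j k : ℕ)
        (ri : 1 ≤ i × i ≤ 5) (rj : 1 ≤ j × j ≤ 5) (rk : 1 ≤ k × k ≤ 5)
        (ab : ∀ x → x ∈ˡ conflicts a b → ¬ Triples.Forbids x i j)
        (ac : ∀ x → x ∈ˡ conflicts a c → ¬ Triples.Forbids x i k)
        (bc : ∀ x → x ∈ˡ conflicts b c → ¬ Triples.Forbids x j k) where

        ρ : Fin m → ℕ
        ρ = set i j k

        a-b : ∀ {x y} → Unit a x → Unit b y → w ρ x ≢ w ρ y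
        a-b ux uy eq = ab _ (∈-conflicts ux uy)
          (trans (sym (w-set-a i j k ux)) (trans eq (w-set-b i j k uy)))
        a-c : ∀ {x y} → Unit a x → Unit c y → w ρ x ≢ w ρ y
        a-c ux uy eq = ac _ (∈-conflicts ux uy)
          (trans (sym (w-set-a i j k ux)) (trans eq (w-set-c i j k uy)))
        b-c : ∀ {x y} → Unit b x → Unit c y → w ρ x ≢ w ρ y
        b-c ux uy eq = bc _ (∈-conflicts ux uy)
          (trans (sym (w-set-b i j k ux)) (trans eq (w-set-c i j k uy)))

        data Cases (e : Fin m) : Set where
          is-a  : e ≡ link a → Cases e
          is-b  : e ≡ link b → Cases e
          is-c  : e ≡ link c → Cases e
          is-h  : e ≡ h → ρ e ≡ ρ₃ e → Cases e
          other : ρ e ≡ ρ₂ e → Cases e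

        cases : ∀ e → Cases e
        cases e with e ≟ᶠ link a | e ≟ᶠ link b | e ≟ᶠ link c | e ≟ᶠ h
        ... | yes eq | _ | _ | _ = is-a eq
        ... | _ | yes eq | _ | _ = is-b eq
        ... | _ | _ | yes eq | _ = is-c eq
        ... | no ≢a | no ≢b | no ≢c | yes refl = is-h refl (set-other i j k ≢a ≢b ≢c)
        ... | no ≢a | no ≢b | no ≢c | no ≢h = other (trans (set-other i j k ≢a ≢b ≢c)
          (h-same e ≢h))

        unchanged : ∀ e → e ∉ A → ρ e ≡ ρ₀ e
        unchanged e e∉ with cases e
        ... | is-a refl = contradiction (link∈A a∈M) e∉
        ... | is-b refl = contradiction (link∈A b∈M) e∉
        ... | is-c refl = contradiction (link∈A c∈M) e∉
        ... | is-h refl _ = contradiction h∈A e∉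
        ... | other eq = trans eq (near-unchanged e e∉)

        range : ∀ e → e ∈ A → 1 ≤ ρ e × ρ e ≤ R
        range e e∈A with cases e
        ... | is-a refl rewrite set-a i j k = proj₁ ri , ≤-trans (proj₂ ri) 5≤R
        ... | is-b refl rewrite set-b i j k = proj₁ rj , ≤-trans (proj₂ rj) 5≤R
        ... | is-c refl rewrite set-c i j k = proj₁ rk , ≤-trans (proj₂ rk) 5≤R
        ... | is-h refl eq rewrite eq = h-range
        ... | other eq rewrite eq = near-range e e∈A

        link-avoids : ∀ {x z} → x ∈ M → x ∈ H h → z ∈ M′ → z ∉ H (link x)
        link-avoids x∈M x∈h z∈ z∈link with link-only x∈M (M′⊆M z∈) z∈link
        ... | inj₁ refl = h-avoids z∈ x∈h
        ... | inj₂ refl = ∈M′⁻ z∈ (hits-mate (inj₁ x∈h))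

        w-inner : ∀ {z} → z ∈ M′ → w ρ z ≡ w ρ₂ z
        w-inner {z} z∈ = w-cong z same
          where
          same : ∀ e → z ∈ H e → ρ e ≡ ρ₂ e
          same e z∈e with cases e
          ... | is-a refl = contradiction z∈e (link-avoids a∈M a∈h z∈)
          ... | is-b refl = contradiction z∈e (link-avoids b∈M b∈h z∈)
          ... | is-c refl = contradiction z∈e (link-avoids c∈M c∈h z∈)
          ... | is-h refl _ = contradiction z∈e (h-avoids z∈)
          ... | other eq = eq

        link-¬separates : ∀ {x u} → x ∈ M → u ∈ M → ¬ Separates (link x) u (μ u)
        link-¬separates x∈M u∈M (inj₁ (u∈ , μu∉)) with link-only x∈M u∈M u∈
        ... | inj₁ refl = μu∉ (μ∈link x∈M)
        ... | inj₂ refl = μu∉ (subst (_∈ H (link _)) (sym (μ-involutive _)) (x∈link x∈M))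
        link-¬separates x∈M u∈M (inj₂ (μu∈ , u∉)) with link-only x∈M (μ∈ u∈M) μu∈
        ... | inj₁ eq = u∉ (subst (_∈ H (link _))
          (trans (cong μ (sym eq)) (μ-involutive _)) (μ∈link x∈M))
        ... | inj₂ eq = u∉ (subst (_∈ H (link _))
          (trans (sym (μ-involutive _)) (trans (cong μ (sym eq)) (μ-involutive _))) (x∈link x∈M))

        -- Mates differ under ρ₃, and a matching edge contains both ends of a pair or neither.
        w-mate : ∀ {u} → u ∈ shadow h → w ρ u ≢ w ρ (μ u)
        w-mate {u} u∈ = w-≢ same (mates u u∈)
          where
          u∈M : u ∈ M
          u∈M = proj₁ (∈⟪⟫⁻ (shadow? h) u∈)
          same : ∀ e → Separates e u (μ u) → ρ₃ e ≡ ρ e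
          same e s = sym (set-other i j k (λ { refl → link-¬separates a∈M u∈M s })
            (λ { refl → link-¬separates b∈M u∈M s }) (λ { refl → link-¬separates c∈M u∈M s }))

        representative : ∀ {e x} → x ∈ M → Hits e x → ∃[ y ] (Unit x y × y ∈ H e × y ∈ M)
        representative x∈M (inj₁ x∈e) = _ , inj₁ refl , x∈e , x∈M
        representative x∈M (inj₂ μx∈e) = _ , inj₂ refl , μx∈e , μ∈ x∈M

        pair : ∀ {e x y} → x ∈ M → y ∈ M → Hits e x → Hits e y →
               (∀ {x′ y′} → Unit x x′ → Unit y y′ → w ρ x′ ≢ w ρ y′) → Bichromatic M ρ e
        pair x∈M y∈M hx hy differ with representative x∈M hx | representative y∈M hy
        ... | x′ , ux , x∈e , x∈ | y′ , uy , y∈e , y∈ =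
          x′ , y′ , (x∈e , x∈) , (y∈e , y∈) , differ ux uy

        -- Edges with two vertices in M′ are left to the inductive solution. If any other edge
        -- contains a pair, that pair is a removed one. The rest meet two of the pairs of a, b, c by
        -- `hits-one-of`.
        bichromatic : ∀ e → e ∈ A → Bichromatic M ρ e
        bichromatic e e∈A with two? M′ e
        ... | yes t with settled e e∈A t
        ... | x , y , (x∈e , x∈) , (y∈e , y∈) , ne =
          x , y , (x∈e , M′⊆M x∈) , (y∈e , M′⊆M y∈) ,
          λ eq → ne (trans (sym (w-inner x∈)) (trans eq (w-inner y∈)))
        bichromatic e e∈A | no ¬t with independent? e
        ... | no ¬ind with dependent ¬ind
        ... | u , u∈M , u∈e , μu∈e = u , μ u , (u∈e , u∈M) , (μu∈e , μ∈ u∈M) ,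
          w-mate (shadow⁺ u∈M (decidable-stable (hits? h u) λ ¬hit → ¬t
            (u , μ u , μ≢ u∈M , (u∈e , ∈M′⁺ u∈M ¬hit) , (μu∈e , μ∈M′ (∈M′⁺ u∈M ¬hit)))))
        bichromatic e e∈A | no ¬t | yes ind-e with hits? e a | hits? e b
        ... | yes ha | yes hb = pair a∈M b∈M ha hb a-b
        ... | yes ha | no ¬hb = pair a∈M c∈M ha
          (hits-one-of e∈A ind-e ¬t b∈M b∈h c∈M c∈h b≢c ¬hb) a-c
        ... | no ¬ha | _ = pair b∈M c∈M (hits-one-of e∈A ind-e ¬t a∈M a∈h b∈M b∈h a≢b ¬ha)
          (hits-one-of e∈A ind-e ¬t a∈M a∈h c∈M c∈h a≢c ¬ha) b-c

      repair : Solution R ρ₀ M A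
      repair with shift-apart (conflicts a b) (conflicts a c) (conflicts b c) ≤-refl ≤-refl ≤-refl
      ... | (i , j , k) , (ri , rj , rk) , ab , ac , bc =
        record { ρ = S.ρ ; unchanged = S.unchanged ; range = S.range ; bichromatic = S.bichromatic }
        where module S = Shifted i j k ri rj rk ab ac bc

    module Combine {ρ₁ : Fin m → ℕ} (near-same : ∀ e → e ∉ˡ near → ρ₁ e ≡ ρ₀ e)
                   (near-range : ∀ e → e ∈ˡ near → 1 ≤ ρ₁ e × ρ₁ e ≤ r + 1)
                   (S : Solution R ρ₁ M′ A′) where

      module S = Solution S

      unchanged : ∀ e → e ∉ A → S.ρ e ≡ ρ₀ e
      unchanged e e∉ = trans (S.unchanged e (e∉ ∘ proj₁ ∘ ∈⟪⟫⁻ inner?))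
                             (near-same e (e∉ ∘ proj₁ ∘ near⁻))

      range : ∀ e → e ∈ A → 1 ≤ S.ρ e × S.ρ e ≤ R
      range e e∈A with two? M′ e
      ... | yes t = S.range e (∈⟪⟫⁺ inner? (e∈A , t))
      ... | no ¬t rewrite S.unchanged e (¬t ∘ proj₂ ∘ ∈⟪⟫⁻ inner?) =
        let lo , hi = near-range e (near⁺ e∈A ¬t) in lo , ≤-trans hi r+1≤R

      combine : (a b c : Fin n) → a ∈ M → b ∈ M → c ∈ M → a ∈ H h → b ∈ H h → c ∈ H h →
                a ≢ b → a ≢ c → b ≢ c → Solution R ρ₀ M A
      combine = let ρ₃ , same , range-h , mates = fix-h S.ρ; lo , hi = range-h h (here refl) in
        Repair.repair S.ρ ρ₃ unchanged range (λ e e∈A t → S.bichromatic e (∈⟪⟫⁺ inner? (e∈A , t)))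
          (λ e e≢h → same e λ { (here eq) → e≢h eq }) (lo , ≤-trans hi r+1≤R) mates

    removal : (a b c : Fin n) → a ∈ M → b ∈ M → c ∈ M → a ∈ H h → b ∈ H h → c ∈ H h →
              a ≢ b → a ≢ c → b ≢ c → Solution R ρ₀ M A
    removal a b c a∈M b∈M c∈M a∈h =
      let ρ₁ , same , range , twins = fix-near in
      Combine.combine same range (solve M′ A′ ρ₁ (smaller a∈M a∈h)
        (λ e e∈ → proj₂ (∈⟪⟫⁻ inner? e∈)) (distinct′ ρ₁ twins)) a b c a∈M b∈M c∈M a∈h

  matching : (∀ M′ A′ ρ → ∣ M′ ∣ < ∣ M ∣ → (∀ e → e ∈ A′ → Two M′ e) →
               (∀ u v → u ∈ M′ → v ∈ M′ → u ≢ v →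
                 ∃[ e ] (e ∈ A′ × Separates e u v) ⊎ w ρ u ≢ w ρ v) →
               Solution R ρ M′ A′) → Solution R ρ₀ M A
  matching solve with any? (λ e → e ∈? A ×-dec independent? e)
  ... | no none = no-independent λ e e∈A ind → none (e , e∈A , ind)
  ... | yes some with argmin (λ e → e ∈? A ×-dec independent? e) (λ e → ∣ shadow e ∣) some
  ... | h , (h∈A , ind) , minimal with twos h h∈A
  ... | a , b , a≢b , (a∈h , a∈M) , (b∈h , b∈M)
    with any? (λ c → c ∈? M ×-dec c ∈? H h ×-dec ¬? (a ≟ᶠ c) ×-dec ¬? (b ≟ᶠ c))
  ... | yes (c , c∈M , c∈h , a≢c , b≢c) =
    Removal.removal h h∈A ind minimal solve a b c a∈M b∈M c∈M a∈h b∈h c∈h a≢b a≢c b≢c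
  -- Otherwise the trace of h has size two, so it is a matched pair.
  ... | no none = contradiction
    (subst (_∈ H h) (pair-mate h∈A a∈h a∈M b∈h b∈M a≢b only-two) b∈h) (ind a a∈M a∈h)
    where
    only-two : ∀ z → z ∈ M → z ∈ H h → z ≡ a ⊎ z ≡ b
    only-two z z∈M z∈h with z ≟ᶠ a | z ≟ᶠ b
    ... | yes eq | _ = inj₁ eq
    ... | no _ | yes eq = inj₂ eq
    ... | no ne₁ | no ne₂ = contradiction (z , z∈M , z∈h , ne₁ ∘ sym , ne₂ ∘ sym) none

-- Induction on the size of M.

module Induction {n m r : ℕ} (H : Hypergraph n m) (size : ∀ e → ∣ H e ∣ ≤ r)
                 (R : ℕ) (5≤R : 5 ≤ R) (r+1≤R : r + 1 ≤ R) where

  open Weights H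
  open Traces H

  Pair : Subset n → Fin m → Fin n → Fin n → Set
  Pair M e u v = u ≢ v × (u ∈ H e × u ∈ M) × (v ∈ H e × v ∈ M) ×
                 (∀ x → x ∈ M → x ∈ H e → x ≡ u ⊎ x ≡ v)

  pair? : ∀ M e u v → Dec (Pair M e u v)
  pair? M e u v = ¬? (u ≟ᶠ v) ×-dec (u ∈? H e ×-dec u ∈? M) ×-dec (v ∈? H e ×-dec v ∈? M) ×-dec
    all? λ x → (x ∈? M) →-dec (x ∈? H e) →-dec (x ≟ᶠ u ⊎-dec x ≟ᶠ v)

  pair-sym : ∀ {M e u v} → Pair M e u v → Pair M e v u
  pair-sym (ne , u∈ , v∈ , cover) = ne ∘ sym , v∈ , u∈ , λ x x∈M x∈e → swap (cover x x∈M x∈e)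

  pair⇒only : ∀ {M e u v} → Pair M e u v → Only (M - u) e v
  pair⇒only {M} {e} {u} {v} (ne , _ , (v∈e , v∈M) , only-uv) =
    (v∈e , x∈p∧x≢y⇒x∈p-y v∈M (ne ∘ sym)) , λ y y∈ y∈e →
      let y∈M , y≢u = ∈-⁻ M y∈ in other y≢u (only-uv y y∈M y∈e)
    where
    other : ∀ {y} → y ≢ u → y ≡ u ⊎ y ≡ v → y ≡ v
    other y≢u (inj₁ y≡u) = contradiction y≡u y≢u
    other y≢u (inj₂ y≡v) = y≡v

  Distinct : Subset n → Subset m → (Fin m → ℕ) → Set
  Distinct M A ρ = ∀ u v → u ∈ M → v ∈ M → u ≢ v →
                   ∃[ e ] (e ∈ A × Separates e u v) ⊎ w ρ u ≢ w ρ v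

  Solvable : Subset n → Set
  Solvable M = ∀ A ρ → (∀ e → e ∈ A → Two M e) → Distinct M A ρ → Solution R ρ M A

  module _ {M : Subset n} (solve : ∀ M′ → ∣ M′ ∣ < ∣ M ∣ → Solvable M′)
           (A : Subset m) (ρ : Fin m → ℕ) (twos : ∀ e → e ∈ A → Two M e)
           (distinct : Distinct M A ρ) where

    Linked : Fin n → Fin n → Set
    Linked u v = ∃[ e ] (e ∈ A × Pair M e u v)

    linked? : ∀ u v → Dec (Linked u v)
    linked? u v = any? λ e → e ∈? A ×-dec pair? M e u v

    linked∈ : ∀ {u v} → Linked u v → u ∈ M
    linked∈ (_ , _ , _ , (_ , u∈M) , _) = u∈M

    linked-sym : ∀ {u v} → Linked u v → Linked v u
    linked-sym (e , e∈A , p) = e , e∈A , pair-sym p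

    branching : ∀ {v a b} → Linked v a → Linked v b → a ≢ b → Solution R ρ M A
    branching {v} (e₁ , e₁∈A , p₁) (e₂ , e₂∈A , p₂) a≢b =
      block v∈M twos inner e₁∈A e₂∈A (pair⇒only p₁) (pair⇒only p₂)
        (proj₁ (proj₁ (proj₂ p₁))) (proj₁ (proj₁ (proj₂ p₂))) a≢b
      where
      open Block H A ρ R 5≤R
      v∈M : v ∈ M
      v∈M = proj₂ (proj₁ (proj₂ p₁))
      inner : ∀ Z → Z ⊆ M - v → (∀ e → e ∈ A → ¬ Avoids Z e → Two Z e) →
              Solution R ρ Z (Meeting Z)
      inner Z Z⊆ stuck = solve Z (≤-<-trans (p⊆q⇒∣p∣≤∣q∣ Z⊆) (x∈p⇒∣p-x∣<∣p∣ v∈M))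
        (Meeting Z) ρ (λ e e∈ → let e∈A , ¬av = ∈⟪⟫⁻ (meeting? Z) e∈ in stuck e e∈A ¬av) distinct′
        where
        meets : ∀ {e u v} → u ∈ Z → v ∈ Z → Separates e u v → ¬ Avoids Z e
        meets u∈ v∈ (inj₁ (u∈e , _)) av = av _ u∈ u∈e
        meets u∈ v∈ (inj₂ (v∈e , _)) av = av _ v∈ v∈e
        distinct′ : Distinct Z (Meeting Z) ρ
        distinct′ x y x∈ y∈ x≢y
          with distinct x y (proj₁ (∈-⁻ M (Z⊆ x∈))) (proj₁ (∈-⁻ M (Z⊆ y∈))) x≢y
        ... | inj₂ d = inj₂ d
        -- An edge separating two vertices of Z contains one of them, so it meets Z and stays free.
        ... | inj₁ (e , e∈A , s) = inj₁ (e , ∈⟪⟫⁺ (meeting? Z) (e∈A , meets x∈ y∈ s) , s)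

    -- A free edge through v has at least three vertices in M, or v would be linked; so two remain
    -- when v is dropped.
    isolated : ∀ {v} → v ∈ M → (∀ u → ¬ Linked v u) → Solution R ρ M A
    isolated {v} v∈M ¬linked = record
      { ρ = S.ρ ; unchanged = S.unchanged ; range = S.range
      ; bichromatic = λ e e∈A → let x , y , (x∈e , x∈) , (y∈e , y∈) , ne = S.bichromatic e e∈A
          in x , y , (x∈e , proj₁ (∈-⁻ M x∈)) , (y∈e , proj₁ (∈-⁻ M y∈)) , ne }
      where
      third : ∀ {e u} → e ∈ A → v ≢ u → v ∈ H e → u ∈ H e → u ∈ M → Two (M - v) e
      third {e} {u} e∈A v≢u v∈e u∈e u∈M
        with any? (λ x → x ∈? M ×-dec x ∈? H e ×-dec ¬? (x ≟ᶠ v) ×-dec ¬? (x ≟ᶠ u))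
      ... | yes (x , x∈M , x∈e , x≢v , x≢u) = x , u , x≢u ,
        (x∈e , x∈p∧x≢y⇒x∈p-y x∈M x≢v) , (u∈e , x∈p∧x≢y⇒x∈p-y u∈M (v≢u ∘ sym))
      ... | no none = contradiction
        (e , e∈A , v≢u , (v∈e , v∈M) , (u∈e , u∈M) , λ x x∈M x∈e →
          decidable-stable (x ≟ᶠ v ⊎-dec x ≟ᶠ u) λ ne →
            none (x , x∈M , x∈e , ne ∘ inj₁ , ne ∘ inj₂)) (¬linked u)
      twos′ : ∀ e → e ∈ A → Two (M - v) e
      twos′ e e∈A with twos e e∈A
      ... | x , y , x≢y , (x∈e , x∈M) , (y∈e , y∈M) with x ≟ᶠ v | y ≟ᶠ v
      ... | yes refl | _ = third e∈A x≢y x∈e y∈e y∈M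
      ... | no _ | yes refl = third e∈A (x≢y ∘ sym) y∈e x∈e x∈M
      ... | no x≢v | no y≢v = x , y , x≢y ,
        (x∈e , x∈p∧x≢y⇒x∈p-y x∈M x≢v) , (y∈e , x∈p∧x≢y⇒x∈p-y y∈M y≢v)
      module S = Solution (solve (M - v) (x∈p⇒∣p-x∣<∣p∣ v∈M) A ρ twos′
        λ x y x∈ y∈ → distinct x y (proj₁ (∈-⁻ M x∈)) (proj₁ (∈-⁻ M y∈)))

    matched : Fin m → (∀ v → v ∈ M → ∃[ u ] Linked v u) →
              (∀ {v a b} → Linked v a → Linked v b → a ≡ b) → Solution R ρ M A
    matched e₀ partner unique = Matching.matching H size R 5≤R r+1≤R M A ρ twos distinct
      μ μ-involutive (λ x∈ → linked∈ (linked-sym (linked x∈)))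
      (λ x∈ → proj₁ (proj₂ (proj₂ (linked x∈))))
      link (λ x∈ → proj₁ (link-pair x∈)) (λ x∈ → proj₁ (proj₁ (proj₂ (proj₂ (link-pair x∈)))))
      (λ x∈ → proj₁ (proj₁ (proj₂ (proj₂ (proj₂ (link-pair x∈))))))
      (λ x∈ y∈ → proj₂ (proj₂ (proj₂ (proj₂ (link-pair x∈)))) _ y∈)
      (λ e∈A x∈e x∈M y∈e y∈M x≢y only-xy →
        unique (_ , e∈A , x≢y , (x∈e , x∈M) , (y∈e , y∈M) , only-xy) (linked x∈M))
      (λ M′ A′ ρ′ lt → solve M′ lt A′ ρ′)
      where
      mate : ∀ v → ∃[ u ] ∃[ e ] ((v ∈ M → e ∈ A × Pair M e v u) × (v ∉ M → u ≡ v))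
      mate v with v ∈? M
      -- Outside M the mate is the vertex itself, which keeps μ an involution everywhere; e₀ is a
      -- placeholder.
      ... | no v∉ = v , e₀ , (λ v∈ → contradiction v∈ v∉) , λ _ → refl
      ... | yes v∈ with partner v v∈
      ... | u , e , l = u , e , (λ _ → l) , λ v∉ → contradiction v∈ v∉
      μ : Fin n → Fin n
      μ v = proj₁ (mate v)
      link : Fin n → Fin m
      link v = proj₁ (proj₂ (mate v))
      link-pair : ∀ {v} → v ∈ M → link v ∈ A × Pair M (link v) v (μ v)
      link-pair {v} v∈ = proj₁ (proj₂ (proj₂ (mate v))) v∈
      linked : ∀ {v} → v ∈ M → Linked v (μ v)
      linked {v} v∈ = link v , link-pair v∈
      fixed : ∀ {v} → v ∉ M → μ v ≡ v
      fixed {v} = proj₂ (proj₂ (proj₂ (mate v)))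
      μ-involutive : ∀ v → μ (μ v) ≡ v
      μ-involutive v = by-cases (v ∈? M)
        where
        by-cases : Dec (v ∈ M) → μ (μ v) ≡ v
        by-cases (yes v∈) =
          unique (linked (linked∈ (linked-sym (linked v∈)))) (linked-sym (linked v∈))
        by-cases (no v∉) = trans (fixed (subst (_∉ M) (sym (fixed v∉)) v∉)) (fixed v∉)

    solution : Solution R ρ M A
    solution with any? (_∈? M)
    ... | no empty = record
      { ρ = ρ ; unchanged = λ _ _ → refl
      ; range = λ e e∈A → contradiction (nonempty (twos e e∈A)) empty
      ; bichromatic = λ e e∈A → contradiction (nonempty (twos e e∈A)) empty }
      where
      nonempty : ∀ {e} → Two M e → ∃[ x ] x ∈ M
      nonempty (x , _ , _ , (_ , x∈M) , _) = x , x∈M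
    ... | yes (x , x∈M)
      with any? (λ v → v ∈? M ×-dec ¬? (any? (linked? v)))
         | any? (λ v → any? λ a → any? λ b → linked? v a ×-dec linked? v b ×-dec ¬? (a ≟ᶠ b))
    ... | yes (v , v∈M , ¬linked) | _ = isolated v∈M λ u l → ¬linked (u , l)
    ... | no _ | yes (v , a , b , l₁ , l₂ , a≢b) = branching l₁ l₂ a≢b
    ... | no all-linked | no ¬branch = matched (proj₁ (proj₂ (partner x x∈M))) partner unique
      where
      partner : ∀ v → v ∈ M → ∃[ u ] Linked v u
      partner v v∈M = decidable-stable (any? (linked? v)) λ ¬l → all-linked (v , v∈M , ¬l)
      unique : ∀ {v a b} → Linked v a → Linked v b → a ≡ b
      unique {v} {a} {b} l₁ l₂ =
        decidable-stable (a ≟ᶠ b) λ a≢b → ¬branch (v , a , b , l₁ , l₂ , a≢b)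

  solve : ∀ k M → ∣ M ∣ < k → Solvable M
  solve (suc k) M (s≤s le) = solution λ M′ lt → solve k M′ (<-≤-trans lt le)

-- Twins and the start of the induction.

theorem8 : ∀ (r : ℕ) → 2 ≤ r →
    ∀ (n m : ℕ) (H : Hypergraph n m) →
    (∀ e → ∣ H e ∣ ≤ r) →
    (∀ e → ¬ TwinSet H (H e)) →
    ∃[ ρ ] (WeightsIn[1, 5 ⊔ (r + 1) ] ρ × ProperlyColors H (vertexWeight H ρ))
theorem8 r _ n m H size ¬twin = S.ρ , (λ e → S.range e ∈⊤) , λ e →
    let u , v , (u∈e , _) , (v∈e , _) , ne = S.bichromatic e ∈⊤ in u , v , u∈e , v∈e , ne
  where
  open Weights H
  open Traces H
  open Induction H size (5 ⊔ (r + 1)) (m≤m⊔n 5 (r + 1)) (m≤n⊔m 5 (r + 1)) using (Distinct; solve)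

  Twins : Fin n → Fin n → Set
  Twins u v = ∀ e → ¬ Separates e u v

  twins? : ∀ u v → Dec (Twins u v)
  twins? u v = all? λ e → ¬? (separates? e u v)

  twins-∈ : ∀ {u v e} → Twins u v → u ∈ H e → v ∈ H e
  twins-∈ {v = v} {e} t u∈ = decidable-stable (v ∈? H e) λ v∉ → t e (inj₁ (u∈ , v∉))

  twins-sym : ∀ {u v} → Twins u v → Twins v u
  twins-sym t e = t e ∘ swap

  twins-trans : ∀ {u v x} → Twins u v → Twins v x → Twins u x
  twins-trans s t e (inj₁ (u∈ , x∉)) = x∉ (twins-∈ t (twins-∈ s u∈))
  twins-trans s t e (inj₂ (x∈ , u∉)) = u∉ (twins-∈ (twins-sym s) (twins-∈ (twins-sym t) x∈))

  first? : ∀ v → Dec (∀ u → toℕ u < toℕ v → ¬ Twins u v)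
  first? v = all? λ u → (toℕ u <? toℕ v) →-dec ¬? (twins? u v)

  M : Subset n
  M = ⟪ first? ⟫

  representative : ∀ v → ∃[ u ] (Twins u v × u ∈ M)
  representative v with argmin (λ u → twins? u v) toℕ (v , λ { e (inj₁ (v∈ , v∉)) → v∉ v∈
                                                             ; e (inj₂ (v∈ , v∉)) → v∉ v∈ })
  ... | u , t , minimal = u , t , ∈⟪⟫⁺ first? λ x x<u t′ → <⇒≱ x<u (minimal x (twins-trans t′ t))

  -- An edge that is not a twin set contains two vertices that are not twins. Their representatives
  -- also lie in the edge, and are distinct because the two are not twins.
  twos : ∀ e → e ∈ everything → Two M e
  twos e _ with any? (λ u → any? λ v → u ∈? H e ×-dec v ∈? H e ×-dec ¬? (twins? u v))
  ... | no none = contradiction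
    (λ u v u∈ v∈ f → let t = decidable-stable (twins? u v) λ ¬t → none (u , v , u∈ , v∈ , ¬t) in
      mk⇔ (twins-∈ t) (twins-∈ (twins-sym t))) (¬twin e)
  ... | yes (u , v , u∈ , v∈ , ¬t) with representative u | representative v
  ... | x , tx , x∈M | y , ty , y∈M = x , y ,
    (λ { refl → ¬t (twins-trans (twins-sym tx) ty) }) ,
    (twins-∈ (twins-sym tx) u∈ , x∈M) , (twins-∈ (twins-sym ty) v∈ , y∈M)

  -- All edges are free at first, so the starting values 1 are overwritten. Of two twins, the one of
  -- larger index is not first in its class and so not in M.
  distinct : Distinct M everything (λ _ → 1)
  distinct u v u∈ v∈ u≢v with any? (λ e → separates? e u v)
  ... | yes (e , s) = inj₁ (e , ∈⊤ , s)
  ... | no none with <-cmp (toℕ u) (toℕ v)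
  ... | tri< lt _ _ = contradiction (λ e s → none (e , s)) (∈⟪⟫⁻ first? v∈ u lt)
  ... | tri≈ _ eq _ = contradiction (toℕ-injective eq) u≢v
  ... | tri> _ _ gt = contradiction (λ e s → none (e , swap s)) (∈⟪⟫⁻ first? u∈ v gt)

  module S = Solution (solve (suc ∣ M ∣) M ≤-refl everything (λ _ → 1) twos distinct)
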